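{- Let $G$ be a graph on $n$ vertices and let $H(G)$ be its hairing. Then $H(G)$ is absolutely palindromic. Moreover, $H(G)$ is palindromic if and only if $H(G)$ is bipartite and $n$ is even, and $H(G)$ is antipalindromic if and only if $H(G)$ is bipartite and $n$ is odd.
   Context: All graphs are finite, simple and undirected. For a graph $G$ on $m$ vertices with adjacency matrix $A_G$, its characteristic polynomial is $\chi_G(\lambda)=\det(\lambda I-A_G)=a_0\lambda^m+a_1\lambda^{m-1}+\dots+a_m$ (so $a_0=1$). $G$ is palindromic if $a_i=a_{m-i}$ for all $i=0,\dots,m$; antipalindromic if $a_i=-a_{m-i}$ for all $i$; absolutely palindromic if $|a_i|=|a_{m-i}|$ for all $i$. The hairing $H(G)$ of $G=(V,E)$ is the graph with vertex set $V\times\{0,1\}$, with $(u,0)\sim(v,0)$ iff $uv\in E$, and $(u,0)\sim(u,1)$ for every $u\in V$, and no other edges (i.e. a pendant vertex is attached to every vertex of $G$); it has $2n$ vertices. -}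

module Defs where

open import Data.Nat using (ℕ; zero; suc; _+_; _∸_; _≤_)
open import Data.Integer as ℤ using (ℤ; ∣_∣) renaming (_+_ to _+ℤ_; _*_ to _*ℤ_; -_ to -ℤ_)
open import Data.Bool using (Bool; true; false; if_then_else_)
open import Data.Fin using (Fin; zero; suc; splitAt; punchIn)
open import Data.Sum using (_⊎_; inj₁; inj₂)
open import Data.List using (List; []; _∷_)
open import Data.Product using (Σ; _×_)
open import Relation.Binary.PropositionalEquality using (_≡_; _≢_)

record Graph (n : ℕ) : Set where
  field
    adj   : Fin n → Fin n → Bool
    sym   : ∀ u v → adj u v ≡ adj v u
    irrefl : ∀ u → adj u u ≡ false
open Graph public

Bipartite : ∀ {n} → Graph n → Set
Bipartite {n} G = Σ (Fin n → Bool) λ c → ∀ u v → adj G u v ≡ true → c u ≢ c v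

-- Hairing: vertex (u,0) is encoded as  u ↑ˡ n  (first block of Fin (n + n)),
-- vertex (u,1) as  n ↑ʳ u  (second block).

eqFin : ∀ {n} → Fin n → Fin n → Bool
eqFin zero    zero    = true
eqFin zero    (suc _) = false
eqFin (suc _) zero    = false
eqFin (suc i) (suc j) = eqFin i j

hairAdj : ∀ {n} → Graph n → Fin (n + n) → Fin (n + n) → Bool
hairAdj {n} G i j with splitAt n i | splitAt n j
... | inj₁ u | inj₁ v = adj G u v
... | inj₁ u | inj₂ v = eqFin u v
... | inj₂ u | inj₁ v = eqFin u v
... | inj₂ u | inj₂ v = false

eqFin-sym : ∀ {n} (i j : Fin n) → eqFin i j ≡ eqFin j i
eqFin-sym zero zero = _≡_.refl
eqFin-sym zero (suc j) = _≡_.refl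
eqFin-sym (suc i) zero = _≡_.refl
eqFin-sym (suc i) (suc j) = eqFin-sym i j

hairSym : ∀ {n} (G : Graph n) i j → hairAdj G i j ≡ hairAdj G j i
hairSym {n} G i j with splitAt n i | splitAt n j
... | inj₁ u | inj₁ v = sym G u v
... | inj₁ u | inj₂ v = eqFin-sym u v
... | inj₂ u | inj₁ v = eqFin-sym u v
... | inj₂ u | inj₂ v = _≡_.refl

hairIrrefl : ∀ {n} (G : Graph n) i → hairAdj G i i ≡ false
hairIrrefl {n} G i with splitAt n i
... | inj₁ u = irrefl G u
... | inj₂ u = _≡_.refl

H : ∀ {n} → Graph n → Graph (n + n)
H G = record { adj = hairAdj G ; sym = hairSym G ; irrefl = hairIrrefl G }

-- Polynomials over ℤ as ascending coefficient lists (p = c₀ + c₁λ + …)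

Poly : Set
Poly = List ℤ

_⊕_ : Poly → Poly → Poly
[] ⊕ q = q
p ⊕ [] = p
(a ∷ p) ⊕ (b ∷ q) = (a +ℤ b) ∷ (p ⊕ q)

scale : ℤ → Poly → Poly
scale c [] = []
scale c (a ∷ p) = (c *ℤ a) ∷ scale c p

_⊗_ : Poly → Poly → Poly
[] ⊗ q = []
(a ∷ p) ⊗ q = scale a q ⊕ (ℤ.0ℤ ∷ (p ⊗ q))

neg : Poly → Poly
neg = scale (ℤ.-1ℤ)

const : ℤ → Poly
const c = c ∷ []

X : Poly
X = ℤ.0ℤ ∷ ℤ.1ℤ ∷ []

coeff : Poly → ℕ → ℤ
coeff [] k = ℤ.0ℤ
coeff (a ∷ p) zero = a
coeff (a ∷ p) (suc k) = coeff p k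

sumFin : ∀ {n} → (Fin n → Poly) → Poly
sumFin {zero} f = []
sumFin {suc n} f = f zero ⊕ sumFin (λ i → f (suc i))

det : ∀ {n} → (Fin n → Fin n → Poly) → Poly
det {zero} M = const ℤ.1ℤ
det {suc n} M = sumFin λ j →
  sign j (M zero j ⊗ det (λ r c → M (suc r) (punchIn j c)))
  where
  sign : ∀ {m} → Fin m → Poly → Poly
  sign zero p = p
  sign (suc j) p = neg (sign j p)

b2ℤ : Bool → ℤ
b2ℤ true = ℤ.1ℤ
b2ℤ false = ℤ.0ℤ

charPoly : ∀ {m} → Graph m → Poly
charPoly G = det λ i j →
  (if eqFin i j then X else []) ⊕ neg (const (b2ℤ (adj G i j)))

a : ∀ {m} → Graph m → ℕ → ℤ
a {m} G i = coeff (charPoly G) (m ∸ i)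

Palindromic : ∀ {m} → Graph m → Set
Palindromic {m} G = ∀ i → i ≤ m → a G i ≡ a G (m ∸ i)

Antipalindromic : ∀ {m} → Graph m → Set
Antipalindromic {m} G = ∀ i → i ≤ m → a G i ≡ -ℤ (a G (m ∸ i))

AbsPalindromic : ∀ {m} → Graph m → Set
AbsPalindromic {m} G = ∀ i → i ≤ m → ∣ a G i ∣ ≡ ∣ a G (m ∸ i) ∣

Even Odd : ℕ → Set
Even n = Σ ℕ λ k → n ≡ k + k
Odd n = Σ ℕ λ k → n ≡ suc (k + k)

{-# OPTIONS --safe #-}
module Submission where

-- Put χ(t) = det(tI − K) and Q(t) = det(I − tK) for the adjacency matrix K of a graph on m vertices,
-- so that the coefficients of Q are those of χ in reverse order. For the hairing, tI − K and I + tK are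
-- intertwined by constant matrices of determinant (−1)ⁿ and 1, whence (−1)ⁿ χ(t) = Q(−t); this gives
-- absolute palindromicity and reduces the two equivalences to: the graph is bipartite iff Q is even.
-- Bipartiteness makes Q even by conjugating with the ±1 diagonal matrix of a 2-colouring. Conversely,
-- Cramer's rule gives 1/Q = W · 1/Q′, where W counts the closed walks at a vertex v and Q′ belongs to
-- the graph without v. By induction 1/Q has nonnegative coefficients and dominates W and 1/Q′, so if
-- Q is even, then there are no closed walks of odd length, neither through v nor avoiding v. A
-- union-find pass over the edges then produces a 2-colouring.

import Defs
open import Defs hiding (det; a; sym)
open import Algebra.Bundles using (CommutativeRing; AbelianGroup)
open import Data.Bool using (Bool; true; false; if_then_else_; not; _xor_)
open import Data.Empty using (⊥; ⊥-elim)
open import Data.Fin as Fin using (Fin; zero; suc; punchIn; splitAt)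
open import Data.Fin.Properties using (suc-injective)
open import Data.Nat as ℕ using (ℕ; zero; suc)
open import Data.Product using (∃; _×_; _,_; proj₂)
open import Data.Sum as Sum using (_⊎_; inj₁; inj₂)
open import Function using (_∘_; id; case_of_)
open import Function.Bundles using (_⇔_; mk⇔; Equivalence)
open import Level using (0ℓ; _⊔_)
open import Relation.Binary.PropositionalEquality as ≡ using (_≡_; _≢_)

-- Determinants over a commutative ring

-- The functional equation reflects the shape of K⁻¹: K = (A I; I 0) has inverse (0 I; I -A), which
-- is similar to -K, so eigenvalues pair up as λ and -1/λ. Intertwining expresses this without
-- eigenvalues and over any commutative ring, once determinants are known to be multiplicative. The
-- obstacle in the converse is that Q is a signed sum, so that its odd coefficients might vanish by
-- cancellation. Passing to 1/Q removes the signs: deleting vertices one at a time factors it into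
-- series that count closed walks, and a single odd closed walk then leaves a positive coefficient.
-- As Q has constant term 1, its reciprocal lives in ℤ[[t]]. Power series are also the convenient
-- home for the determinants, since coefficient lists with trailing zeros do not form a ring under
-- `_≡_`.

module Determinant {c ℓ} (R : CommutativeRing c ℓ) where
  open CommutativeRing R hiding (zero)
  open import Data.Vec.Functional using (_∷_)
  open import Algebra.Properties.Semiring.Sum semiring
    using (sum; sum-cong-≋; ∑-distrib-+; *-distribˡ-sum; sum-replicate-zero; sum-remove)
  open import Algebra.Properties.Ring ring
    using (-‿distribˡ-*; -‿distribʳ-*; -0#≈0#; -‿involutive; -1*x≈-x; +-inverseˡ-unique)
  open import Algebra.Properties.CommutativeSemigroup *-commutativeSemigroup using (x∙yz≈y∙xz)
  open import Algebra.Properties.Semiring.Exp semiring using (_^_)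
  open import Relation.Binary.Reasoning.Setoid setoid

  Row : ℕ → Set c
  Row n = Fin n → Carrier

  Matrix : ℕ → Set c
  Matrix n = Fin n → Row n

  infix 4 _≋_
  _≋_ : ∀ {n} → Row n → Row n → Set ℓ
  u ≋ v = ∀ j → u j ≈ v j

  opaque
    -- Sealed so that conversion checking never unfolds nested sums; everything outside the block
    -- relies only on the laws listed here.
    ∑ : ∀ {n} → Row n → Carrier
    ∑ = sum

    ∑-empty : (f : Row 0) → ∑ f ≈ 0#
    ∑-empty f = refl

    ∑-suc : ∀ {n} (f : Row (suc n)) → ∑ f ≈ f zero + ∑ (f ∘ suc)
    ∑-suc f = refl

    ∑-cong : ∀ {n} {f g : Row n} → f ≋ g → ∑ f ≈ ∑ g
    ∑-cong = sum-cong-≋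

    ∑-+ : ∀ {n} (f g : Row n) → ∑ (λ i → f i + g i) ≈ ∑ f + ∑ g
    ∑-+ = ∑-distrib-+

    *-distribˡ-∑ : ∀ {n} a (f : Row n) → a * ∑ f ≈ ∑ (λ i → a * f i)
    *-distribˡ-∑ = *-distribˡ-sum

    ∑-zero : ∀ {n} {f : Row n} → (∀ i → f i ≈ 0#) → ∑ f ≈ 0#
    ∑-zero {n} f≈0 = trans (sum-cong-≋ f≈0) (sum-replicate-zero n)

    ∑-remove : ∀ {n} k (f : Row (suc n)) → ∑ f ≈ f k + ∑ (f ∘ punchIn k)
    ∑-remove k f = sum-remove {i = k} f

  ∑-linear : ∀ {n} a (f g : Row n) → ∑ (λ i → a * f i + g i) ≈ a * ∑ f + ∑ g
  ∑-linear a f g = trans (∑-+ (λ i → a * f i) g) (+-congʳ (sym (*-distribˡ-∑ a f)))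

  ∑-neg : ∀ {n} (f : Row n) → ∑ (λ i → - f i) ≈ - ∑ f
  ∑-neg f = begin
    ∑ (λ i → - f i)       ≈⟨ ∑-cong (λ i → -1*x≈-x (f i)) ⟨
    ∑ (λ i → - 1# * f i)  ≈⟨ *-distribˡ-∑ (- 1#) f ⟨
    - 1# * ∑ f            ≈⟨ -1*x≈-x _ ⟩
    - ∑ f                 ∎

  sgn : ∀ {n} → Fin n → Carrier
  sgn zero    = 1#
  sgn (suc j) = - sgn j

  minor : ∀ {n} → Matrix (suc n) → Fin (suc n) → Matrix n
  minor M j r c = M (suc r) (punchIn j c)

  det : ∀ {n} → Matrix n → Carrier
  det {zero}  M = 1#
  det {suc n} M = ∑ λ j → sgn j * (M zero j * det (minor M j))

  -- Consecutive indices. Demanding alternation only for neighbouring rows suits an induction on the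
  -- Laplace expansion; `swap` and `repeated-head` recover the case of distant rows.
  data Next : ∀ {n} → Fin n → Fin n → Set where
    here  : ∀ {n} → Next {suc (suc n)} zero (suc zero)
    there : ∀ {n} {i j : Fin n} → Next i j → Next (suc i) (suc j)

  -- The row length `m` is independent of the number `n` of rows because the inductions below freeze
  -- rows one at a time. Linearity compares three families that agree off row `i`, which avoids
  -- updating a family at an index, and it bundles scaling with addition.
  record IsAlternating {n m} (F : (Fin n → Row m) → Carrier) : Set (c ⊔ ℓ) where
    field
      cong : ∀ {r s} → (∀ i → r i ≋ s i) → F r ≈ F s
      linear : ∀ i a {r s t} →
        (∀ k → k ≢ i → t k ≋ r k) → (∀ k → k ≢ i → t k ≋ s k) →
        (∀ j → t i j ≈ a * r i j + s i j) → F t ≈ a * F r + F s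
      alternating : ∀ {i j r} → Next i j → r i ≋ r j → F r ≈ 0#
  open IsAlternating

  det-cong : ∀ {n} {M N : Matrix n} → (∀ i → M i ≋ N i) → det M ≈ det N
  det-cong {zero}  M≋N = refl
  det-cong {suc n} M≋N = ∑-cong λ j →
    *-congˡ (*-cong (M≋N zero j) (det-cong λ r c → M≋N (suc r) (punchIn j c)))

  det-linear : ∀ {n} (i : Fin n) a {r s t : Matrix n} →
    (∀ k → k ≢ i → t k ≋ r k) → (∀ k → k ≢ i → t k ≋ s k) →
    (∀ j → t i j ≈ a * r i j + s i j) → det t ≈ a * det r + det s
  det-linear {suc n} zero a {r} {s} {t} t≋r t≋s tᵢ = trans (∑-cong term) (∑-linear a _ _)
    where
    term : ∀ j → sgn j * (t zero j * det (minor t j)) ≈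
      a * (sgn j * (r zero j * det (minor r j))) + sgn j * (s zero j * det (minor s j))
    term j = begin
      sgn j * (t zero j * D)                                    ≈⟨ *-congˡ (*-congʳ (tᵢ j)) ⟩
      sgn j * ((a * r zero j + s zero j) * D)                   ≈⟨ *-congˡ (distribʳ D _ _) ⟩
      sgn j * (a * r zero j * D + s zero j * D)                 ≈⟨ distribˡ _ _ _ ⟩
      sgn j * (a * r zero j * D) + sgn j * (s zero j * D)       ≈⟨ +-congʳ (*-congˡ (*-assoc a _ D)) ⟩
      sgn j * (a * (r zero j * D)) + sgn j * (s zero j * D)     ≈⟨ +-congʳ (x∙yz≈y∙xz _ a _) ⟩
      a * (sgn j * (r zero j * D)) + sgn j * (s zero j * D)
        ≈⟨ +-cong (*-congˡ (*-congˡ (*-congˡ (det-cong λ k c → t≋r (suc k) (λ ()) (punchIn j c)))))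
                  (*-congˡ (*-congˡ (det-cong λ k c → t≋s (suc k) (λ ()) (punchIn j c)))) ⟩
      a * (sgn j * (r zero j * det (minor r j))) + sgn j * (s zero j * det (minor s j)) ∎
      where D = det (minor t j)
  det-linear {suc n} (suc i) a {r} {s} {t} t≋r t≋s tᵢ = trans (∑-cong term) (∑-linear a _ _)
    where
    term : ∀ j → sgn j * (t zero j * det (minor t j)) ≈
      a * (sgn j * (r zero j * det (minor r j))) + sgn j * (s zero j * det (minor s j))
    term j = begin
      sgn j * (t₀ * det (minor t j))
        ≈⟨ *-congˡ (*-congˡ (det-linear i a
             (λ k k≢i c → t≋r (suc k) (k≢i ∘ suc-injective) (punchIn j c))
             (λ k k≢i c → t≋s (suc k) (k≢i ∘ suc-injective) (punchIn j c))
             (λ c → tᵢ (punchIn j c)))) ⟩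
      sgn j * (t₀ * (a * D + E))               ≈⟨ *-congˡ (distribˡ t₀ _ _) ⟩
      sgn j * (t₀ * (a * D) + t₀ * E)          ≈⟨ distribˡ _ _ _ ⟩
      sgn j * (t₀ * (a * D)) + sgn j * (t₀ * E) ≈⟨ +-congʳ (*-congˡ (x∙yz≈y∙xz t₀ a D)) ⟩
      sgn j * (a * (t₀ * D)) + sgn j * (t₀ * E) ≈⟨ +-congʳ (x∙yz≈y∙xz _ a _) ⟩
      a * (sgn j * (t₀ * D)) + sgn j * (t₀ * E)
        ≈⟨ +-cong (*-congˡ (*-congˡ (*-congʳ (t≋r zero (λ ()) j)))) (*-congˡ (*-congʳ (t≋s zero (λ ()) j))) ⟩
      a * (sgn j * (r zero j * D)) + sgn j * (s zero j * E) ∎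
      where
      t₀ = t zero j
      D = det (minor r j)
      E = det (minor s j)

  -- The terms (j , k) and (punchIn j k , k′) selecting the same two columns in the opposite
  -- order cancel; D f stands for the minor on the columns in the image of f.
  double-expansion : ∀ {n} (v : Row (suc (suc n))) (D : (Fin n → Fin (suc (suc n))) → Carrier) →
    (∀ {f g} → (∀ i → f i ≡ g i) → D f ≈ D g) →
    ∑ (λ j → sgn j * (v j * ∑ (λ k → sgn k * (v (punchIn j k) * D (punchIn j ∘ punchIn k))))) ≈ 0#
  double-expansion {n} v D D-cong = begin
    ∑ (λ j → sgn j * (v j * ∑ (λ k → sgn k * (v (punchIn j k) * D (punchIn j ∘ punchIn k)))))
      ≈⟨ ∑-suc _ ⟩
    1# * (v zero * A) + ∑ (λ j → - sgn j * (v (suc j) *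
      ∑ (λ k → sgn k * (v (punchIn (suc j) k) * D (punchIn (suc j) ∘ punchIn k)))))
      ≈⟨ +-congˡ (∑-cong λ j → *-congˡ (*-congˡ (∑-suc _))) ⟩
    1# * (v zero * A) + ∑ (λ j → - sgn j * (v (suc j) * (1# * (v zero * D (punchIn (suc j) ∘ suc)) + B j)))
      ≈⟨ +-cong first (∑-cong rest) ⟩
    ∑ P + ∑ (λ j → - P j + Q j)       ≈⟨ +-congˡ (∑-+ (λ j → - P j) Q) ⟩
    ∑ P + (∑ (λ j → - P j) + ∑ Q)   ≈⟨ +-assoc _ _ _ ⟨
    ∑ P + ∑ (λ j → - P j) + ∑ Q     ≈⟨ +-cong (sym (∑-+ P (λ j → - P j))) (∑Q≈0 v D D-cong) ⟩
    ∑ (λ j → P j + - P j) + 0#          ≈⟨ +-identityʳ _ ⟩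
    ∑ (λ j → P j + - P j)               ≈⟨ ∑-zero (λ j → -‿inverseʳ (P j)) ⟩
    0# ∎
    where
    A = ∑ (λ k → sgn k * (v (suc k) * D (suc ∘ punchIn k)))
    B = λ j → ∑ (λ k → - sgn k * (v (suc (punchIn j k)) * D (punchIn (suc j) ∘ punchIn (suc k))))
    -- `P` collects the choices of column zero first and a later column second. The same pairs in
    -- the other order contribute `- P`, and `Q` collects the pairs that avoid column zero, which
    -- form a smaller instance of the same sum.
    P = λ k → v zero * (sgn k * (v (suc k) * D (suc ∘ punchIn k)))
    Q = λ j → - sgn j * (v (suc j) * B j)
    first : 1# * (v zero * A) ≈ ∑ P
    first = trans (*-identityˡ _) (*-distribˡ-∑ (v zero) _)
    rest : ∀ j → - sgn j * (v (suc j) * (1# * (v zero * D (punchIn (suc j) ∘ suc)) + B j)) ≈ - P j + Q j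
    rest j = begin
      - sgn j * (v (suc j) * (1# * (v zero * d) + B j))              ≈⟨ *-congˡ (distribˡ _ _ _) ⟩
      - sgn j * (v (suc j) * (1# * (v zero * d)) + v (suc j) * B j)  ≈⟨ distribˡ _ _ _ ⟩
      - sgn j * (v (suc j) * (1# * (v zero * d))) + Q j              ≈⟨ +-congʳ (*-congˡ (*-congˡ (*-identityˡ _))) ⟩
      - sgn j * (v (suc j) * (v zero * d)) + Q j                     ≈⟨ +-congʳ (*-congˡ (x∙yz≈y∙xz _ _ _)) ⟩
      - sgn j * (v zero * (v (suc j) * d)) + Q j                     ≈⟨ +-congʳ (sym (-‿distribˡ-* _ _)) ⟩
      - (sgn j * (v zero * (v (suc j) * d))) + Q j                   ≈⟨ +-congʳ (-‿cong (x∙yz≈y∙xz _ _ _)) ⟩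
      - P j + Q j ∎
      where d = D (punchIn (suc j) ∘ suc)
    ∑Q≈0 : ∀ {n} (v : Row (suc (suc n))) (D : (Fin n → Fin (suc (suc n))) → Carrier) →
      (∀ {f g} → (∀ i → f i ≡ g i) → D f ≈ D g) →
      ∑ (λ j → - sgn j * (v (suc j) *
        ∑ (λ k → - sgn k * (v (suc (punchIn j k)) * D (punchIn (suc j) ∘ punchIn (suc k)))))) ≈ 0#
    ∑Q≈0 {zero}  v D D-cong = ∑-zero λ j → trans (*-congˡ (trans (*-congˡ (∑-empty _)) (zeroʳ _))) (zeroʳ _)
    ∑Q≈0 {suc n} v D D-cong = trans (∑-cong λ j → signs j) (double-expansion (v ∘ suc) D′ D′-cong)
      where
      -- Column zero is not selected, so it survives in every remaining minor and is put back in
      -- front.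
      D′ : (Fin n → Fin (suc (suc n))) → Carrier
      D′ f = D (zero ∷ (suc ∘ f))
      D′-cong : ∀ {f g} → (∀ i → f i ≡ g i) → D′ f ≈ D′ g
      D′-cong f≡g = D-cong λ { zero → ≡.refl ; (suc i) → ≡.cong suc (f≡g i) }
      neg-neg : ∀ x y z → - x * (y * - z) ≈ x * (y * z)
      neg-neg x y z = begin
        - x * (y * - z)   ≈⟨ *-congˡ (-‿distribʳ-* y z) ⟨
        - x * - (y * z)   ≈⟨ -‿distribˡ-* _ _ ⟨
        - (x * - (y * z)) ≈⟨ -‿cong (-‿distribʳ-* _ _) ⟨
        - - (x * (y * z)) ≈⟨ -‿involutive _ ⟩
        x * (y * z) ∎
      signs : ∀ j →
        - sgn j * (v (suc j) *
          ∑ (λ k → - sgn k * (v (suc (punchIn j k)) * D (punchIn (suc j) ∘ punchIn (suc k))))) ≈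
        sgn j * (v (suc j) * ∑ (λ k → sgn k * (v (suc (punchIn j k)) * D′ (punchIn j ∘ punchIn k))))
      signs j = trans (*-congˡ (*-congˡ (trans (∑-cong λ k → trans (sym (-‿distribˡ-* _ _))
          (-‿cong (*-congˡ (*-congˡ (D-cong λ { zero → ≡.refl ; (suc i) → ≡.refl })))))
          (∑-neg _))))
        (neg-neg _ _ _)

  det-alternating : ∀ {n} {i j : Fin n} {M : Matrix n} → Next i j → M i ≋ M j → det M ≈ 0#
  det-alternating {M = M} here M₀≋M₁ = trans
    (∑-cong λ j → *-congˡ (*-congˡ (∑-cong λ k → *-congˡ (*-congʳ (sym (M₀≋M₁ (punchIn j k)))))))
    (double-expansion (M zero) (λ f → det λ r c → M (suc (suc r)) (f c))
      λ f≡g → det-cong λ r c → reflexive (≡.cong (M (suc (suc r))) (f≡g c)))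
  det-alternating (there i→j) Mᵢ≋Mⱼ = ∑-zero λ k →
    trans (*-congˡ (trans (*-congˡ (det-alternating i→j λ c → Mᵢ≋Mⱼ (punchIn k c))) (zeroʳ _))) (zeroʳ _)

  det-isAlternating : ∀ {n} → IsAlternating (det {n})
  det-isAlternating = record { cong = det-cong ; linear = det-linear ; alternating = det-alternating }

  η-rows : ∀ {n m} (r : Fin (suc n) → Row m) i → (r zero ∷ (r ∘ suc)) i ≋ r i
  η-rows r zero    j = refl
  η-rows r (suc i) j = refl

  -- Alternating multilinear forms in the rows

  module Alternating {m : ℕ} where
    Form : ℕ → Set c
    Form n = (Fin n → Row m) → Carrier

    consRows : ∀ {n u v} {r s : Fin n → Row m} → u ≋ v → (∀ i → r i ≋ s i) → ∀ i → (u ∷ r) i ≋ (v ∷ s) i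
    consRows u≋v r≋s zero    = u≋v
    consRows u≋v r≋s (suc i) = r≋s i

    -- The induction device of this module: a form in one row fewer is obtained by freezing the
    -- head.
    fixFirst : ∀ {n} {F : Form (suc n)} → IsAlternating F → ∀ v → IsAlternating (λ r → F (v ∷ r))
    fixFirst alt v = record
      { cong = λ r≋s → cong alt (consRows (λ _ → refl) r≋s)
      ; linear = λ i a t≋r t≋s tᵢ → linear alt (suc i) a
          (λ { zero _ _ → refl ; (suc k) k≢i → t≋r k (k≢i ∘ ≡.cong suc) })
          (λ { zero _ _ → refl ; (suc k) k≢i → t≋s k (k≢i ∘ ≡.cong suc) }) tᵢ
      ; alternating = λ i→j → alternating alt (there i→j)
      }

    linear-head : ∀ {n} {F : Form (suc n)} → IsAlternating F → ∀ a u v r →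
      F ((λ j → a * u j + v j) ∷ r) ≈ a * F (u ∷ r) + F (v ∷ r)
    linear-head alt a u v r = linear alt zero a
      (λ { zero 0≢0 → ⊥-elim (0≢0 ≡.refl) ; (suc k) _ _ → refl })
      (λ { zero 0≢0 → ⊥-elim (0≢0 ≡.refl) ; (suc k) _ _ → refl }) (λ j → refl)

    additive-head : ∀ {n} {F : Form (suc n)} → IsAlternating F → ∀ u v r →
      F ((λ j → u j + v j) ∷ r) ≈ F (u ∷ r) + F (v ∷ r)
    additive-head alt u v r = trans
      (cong alt (consRows (λ j → +-congʳ (sym (*-identityˡ (u j)))) λ _ _ → refl))
      (trans (linear-head alt 1# u v r) (+-congʳ (*-identityˡ _)))

    linear-combination : ∀ {n k} {F : Form (suc n)} → IsAlternating F → ∀ (a : Row k) (b : Fin k → Row m) r →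
      F ((λ j → ∑ λ c → a c * b c j) ∷ r) ≈ ∑ λ c → a c * F (b c ∷ r)
    linear-combination {k = zero} {F} alt a b r = begin
      -- The empty combination `s` is a zero row. As linearity is available only in its combined
      -- form, `s` is rewritten as -s + s to make the value cancel.
      F (s ∷ r)                       ≈⟨ cong alt (consRows s≈-s+s λ _ _ → refl) ⟩
      F ((λ j → - 1# * s j + s j) ∷ r) ≈⟨ linear-head alt (- 1#) s s r ⟩
      - 1# * F (s ∷ r) + F (s ∷ r)    ≈⟨ +-congʳ (-1*x≈-x _) ⟩
      - F (s ∷ r) + F (s ∷ r)         ≈⟨ -‿inverseˡ _ ⟩
      0#                              ≈⟨ ∑-empty _ ⟨
      ∑ (λ c → a c * F (b c ∷ r))     ∎
      where
      s : Row m
      s j = ∑ λ c → a c * b c j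
      s≈-s+s : ∀ j → s j ≈ - 1# * s j + s j
      s≈-s+s j = trans (∑-empty _) (sym (trans (+-congʳ (-1*x≈-x _)) (-‿inverseˡ _)))
    linear-combination {k = suc k} {F} alt a b r = begin
      F ((λ j → ∑ λ c → a c * b c j) ∷ r)
        ≈⟨ cong alt (consRows (λ j → ∑-suc _) λ _ _ → refl) ⟩
      F ((λ j → a zero * b zero j + ∑ λ c → a (suc c) * b (suc c) j) ∷ r)
        ≈⟨ linear-head alt (a zero) (b zero) _ r ⟩
      a zero * F (b zero ∷ r) + F ((λ j → ∑ λ c → a (suc c) * b (suc c) j) ∷ r)
        ≈⟨ +-congˡ (linear-combination alt (a ∘ suc) (b ∘ suc) r) ⟩
      a zero * F (b zero ∷ r) + ∑ (λ c → a (suc c) * F (b (suc c) ∷ r))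
        ≈⟨ ∑-suc _ ⟨
      ∑ (λ c → a c * F (b c ∷ r)) ∎

    -- Polarization: the form vanishes at (u + v, u + v), and the two diagonal terms of its
    -- expansion vanish as well.
    swap : ∀ {n} {F : Form (suc (suc n))} → IsAlternating F → ∀ u v r →
      F (u ∷ v ∷ r) ≈ - F (v ∷ u ∷ r)
    swap {F = F} alt u v r = +-inverseˡ-unique _ _ (begin
      F (u ∷ v ∷ r) + F (v ∷ u ∷ r)                 ≈⟨ +-cong (pad u v) (trans (pad v u) (+-comm _ _)) ⟩
      (F (u ∷ u ∷ r) + F (u ∷ v ∷ r)) + (F (v ∷ u ∷ r) + F (v ∷ v ∷ r))
        ≈⟨ +-cong (additive-head (fixFirst alt u) u v r) (additive-head (fixFirst alt v) u v r) ⟨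
      F (u ∷ w ∷ r) + F (v ∷ w ∷ r)                 ≈⟨ additive-head alt u v (w ∷ r) ⟨
      F (w ∷ w ∷ r)                                 ≈⟨ alternating alt here (λ _ → refl) ⟩
      0#                                            ∎)
      where
      w : Row m
      w j = u j + v j
      pad : ∀ x y → F (x ∷ y ∷ r) ≈ F (x ∷ x ∷ r) + F (x ∷ y ∷ r)
      pad x y = sym (trans (+-congʳ (alternating alt here (λ _ → refl))) (+-identityˡ _))

    -- Transpositions carry the head downwards until it stands next to its copy.
    repeated-head : ∀ {n} {F : Form (suc n)} → IsAlternating F → ∀ v r k → r k ≋ v → F (v ∷ r) ≈ 0#
    repeated-head alt v r zero r₀≋v = alternating alt here (λ j → sym (r₀≋v j))
    repeated-head {suc n} {F} alt v r (suc k) rₖ≋v = begin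
      F (v ∷ r)                         ≈⟨ cong alt (consRows (λ _ → refl) λ i j → sym (η-rows r i j)) ⟩
      F (v ∷ r zero ∷ (r ∘ suc))        ≈⟨ swap alt v (r zero) (r ∘ suc) ⟩
      - F (r zero ∷ v ∷ (r ∘ suc))      ≈⟨ -‿cong (repeated-head (fixFirst alt (r zero)) v (r ∘ suc) k rₖ≋v) ⟩
      - 0#                              ≈⟨ -0#≈0# ⟩
      0#                                ∎

    -- Row elimination with a row `v` that is not among the arguments of `F`. The assumption on `v`
    -- is met when `F` itself arises by freezing `v` as a head, by `repeated-head`.
    drop-multiples : ∀ {n} {F : Form n} → IsAlternating F → ∀ v → (∀ r k → r k ≋ v → F r ≈ 0#) →
      ∀ (a : Row n) s → F (λ i j → a i * v j + s i j) ≈ F s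
    drop-multiples {zero} alt v v≈0 a s = cong alt λ ()
    drop-multiples {suc n} {F} alt v v≈0 a s = begin
      F (λ i j → a i * v j + s i j)
        ≈⟨ cong alt (λ i j → sym (η-rows (λ i j → a i * v j + s i j) i j)) ⟩
      F ((λ j → a zero * v j + s zero j) ∷ rest)     ≈⟨ linear-head alt (a zero) v (s zero) rest ⟩
      a zero * F (v ∷ rest) + F (s zero ∷ rest)      ≈⟨ +-congʳ (*-congˡ (v≈0 (v ∷ rest) zero λ _ → refl)) ⟩
      a zero * 0# + F (s zero ∷ rest)                ≈⟨ +-congʳ (zeroʳ _) ⟩
      0# + F (s zero ∷ rest)                         ≈⟨ +-identityˡ _ ⟩
      F (s zero ∷ rest)
        ≈⟨ drop-multiples (fixFirst alt (s zero)) v (λ r k → v≈0 (s zero ∷ r) (suc k)) (a ∘ suc) (s ∘ suc) ⟩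
      F (s zero ∷ (s ∘ suc))                         ≈⟨ cong alt (η-rows s) ⟩
      F s                                            ∎
      where
      rest : Fin n → Row m
      rest i j = a (suc i) * v j + s (suc i) j

    rotate : ∀ {n} {F : Form (suc n)} → IsAlternating F → ∀ b k →
      F (b k ∷ (b ∘ punchIn k)) ≈ sgn k * F b
    rotate alt b zero = trans (cong alt (η-rows b)) (sym (*-identityˡ _))
    rotate {suc n} {F} alt b (suc k) = begin
      F (b (suc k) ∷ (b ∘ punchIn (suc k)))
        ≈⟨ cong alt (consRows (λ _ → refl) λ { zero _ → refl ; (suc i) _ → refl }) ⟩
      F (b (suc k) ∷ b zero ∷ (b ∘ suc ∘ punchIn k))    ≈⟨ swap alt _ _ _ ⟩
      - F (b zero ∷ b (suc k) ∷ (b ∘ suc ∘ punchIn k))  ≈⟨ -‿cong (rotate (fixFirst alt (b zero)) (b ∘ suc) k) ⟩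
      - (sgn k * F (b zero ∷ (b ∘ suc)))                ≈⟨ -‿cong (*-congˡ (cong alt (η-rows b))) ⟩
      - (sgn k * F b)                                   ≈⟨ -‿distribˡ-* _ _ ⟩
      - sgn k * F b                                     ∎

    -- An alternating form is determined up to the factor `det M`: expanding its first argument
    -- reproduces the Laplace expansion of `M`. The form must be arbitrary because the induction
    -- passes to forms with a frozen head; the case `F = det` is multiplicativity.
    form-of-combinations : ∀ {n} {F : Form n} → IsAlternating F → ∀ (M : Matrix n) b →
      F (λ i j → ∑ λ k → M i k * b k j) ≈ det M * F b
    form-of-combinations {zero} alt M b = trans (cong alt λ ()) (sym (*-identityˡ _))
    form-of-combinations {suc n} {F} alt M b = begin
      F (λ i j → ∑ λ k → M i k * b k j)
        ≈⟨ cong alt (λ i j → sym (η-rows (λ i j → ∑ λ k → M i k * b k j) i j)) ⟩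
      F ((λ j → ∑ λ k → M zero k * b k j) ∷ rest) ≈⟨ linear-combination alt (M zero) b rest ⟩
      ∑ (λ k → M zero k * F (b k ∷ rest))       ≈⟨ ∑-cong term ⟩
      ∑ (λ k → F b * (sgn k * (M zero k * det (minor M k)))) ≈⟨ *-distribˡ-∑ (F b) _ ⟨
      F b * det M                               ≈⟨ *-comm _ _ ⟩
      det M * F b                               ∎
      where
      rest : Fin n → Row m
      rest i j = ∑ λ k → M (suc i) k * b k j
      term : ∀ k → M zero k * F (b k ∷ rest) ≈ F b * (sgn k * (M zero k * det (minor M k)))
      term k = begin
        M zero k * F (b k ∷ rest)
          -- With `b k` frozen as head, its multiples in the other rows drop out. What remains
          -- combines the other members of `b` with coefficient matrix `minor M k`.
          ≈⟨ *-congˡ (cong (fixFirst alt (b k)) λ i j → ∑-remove k _) ⟩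
        M zero k * F (b k ∷ λ i j → M (suc i) k * b k j + ∑ λ l → minor M k i l * b (punchIn k l) j)
          ≈⟨ *-congˡ (drop-multiples (fixFirst alt (b k)) (b k) (repeated-head alt (b k)) _ _) ⟩
        M zero k * F (b k ∷ λ i j → ∑ λ l → minor M k i l * b (punchIn k l) j)
          ≈⟨ *-congˡ (form-of-combinations (fixFirst alt (b k)) (minor M k) (b ∘ punchIn k)) ⟩
        M zero k * (det (minor M k) * F (b k ∷ (b ∘ punchIn k)))
          ≈⟨ *-congˡ (*-congˡ (rotate alt b k)) ⟩
        M zero k * (det (minor M k) * (sgn k * F b))
          ≈⟨ *-assoc _ _ _ ⟨
        M zero k * det (minor M k) * (sgn k * F b)
          ≈⟨ x∙yz≈y∙xz _ _ _ ⟩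
        sgn k * (M zero k * det (minor M k) * F b)
          ≈⟨ *-assoc _ _ _ ⟨
        sgn k * (M zero k * det (minor M k)) * F b
          ≈⟨ *-comm _ _ ⟩
        F b * (sgn k * (M zero k * det (minor M k))) ∎

  open Alternating

  infixl 7 _·_
  _·_ : ∀ {n} → Matrix n → Matrix n → Matrix n
  (M · N) i j = ∑ λ k → M i k * N k j

  det-· : ∀ {n} (M N : Matrix n) → det (M · N) ≈ det M * det N
  det-· = form-of-combinations det-isAlternating

  -- Triangular shapes and Cramer's rule

  det-lower : ∀ {n} (M : Matrix (suc n)) → (∀ j → M zero (suc j) ≈ 0#) →
    det M ≈ M zero zero * det (λ i j → M (suc i) (suc j))
  det-lower M M₀≈0 = begin
    det M ≈⟨ ∑-suc _ ⟩
    1# * (M zero zero * det (minor M zero)) + _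
      ≈⟨ +-cong (*-identityˡ _) (∑-zero λ j → trans (*-congˡ (trans (*-congʳ (M₀≈0 j)) (zeroˡ _))) (zeroʳ _)) ⟩
    M zero zero * det (minor M zero) + 0# ≈⟨ +-identityʳ _ ⟩
    M zero zero * det (minor M zero) ∎

  det-zero-column : ∀ {n} (M : Matrix (suc n)) → (∀ i → M i zero ≈ 0#) → det M ≈ 0#
  det-zero-column {n} M M₀≈0 = ∑-zero λ
    { zero → trans (*-congˡ (trans (*-congʳ (M₀≈0 zero)) (zeroˡ _))) (zeroʳ _)
    ; (suc j) → trans (*-congˡ (trans (*-congˡ (minor≈0 M M₀≈0 j)) (zeroʳ _))) (zeroʳ _) }
    where
    minor≈0 : ∀ {n} (M : Matrix (suc n)) → (∀ i → M i zero ≈ 0#) → ∀ j → det (minor M (suc j)) ≈ 0#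
    minor≈0 {suc n} M M₀≈0 j = det-zero-column (minor M (suc j)) (λ i → M₀≈0 (suc i))

  det-upper : ∀ {n} (M : Matrix (suc n)) → (∀ i → M (suc i) zero ≈ 0#) →
    det M ≈ M zero zero * det (λ i j → M (suc i) (suc j))
  det-upper {n} M M₀≈0 = begin
    det M ≈⟨ ∑-suc _ ⟩
    1# * (M zero zero * det (minor M zero)) + _
      ≈⟨ +-cong (*-identityˡ _) 
          (∑-zero λ j → trans (*-congˡ (trans (*-congˡ (minor≈0 M M₀≈0 j)) (zeroʳ _))) (zeroʳ _)) ⟩
    M zero zero * det (minor M zero) + 0# ≈⟨ +-identityʳ _ ⟩
    M zero zero * det (minor M zero) ∎
    where
    minor≈0 : ∀ {n} (M : Matrix (suc n)) → (∀ i → M (suc i) zero ≈ 0#) → ∀ j → det (minor M (suc j)) ≈ 0#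
    minor≈0 {suc n} M M₀≈0 j = det-zero-column (minor M (suc j)) M₀≈0

  -- Replace row zero of `M` by v M = (1, 0, ..., 0). By linearity in that row, each later row
  -- `M (suc k)` placed there is a repetition and contributes nothing, so only `v zero * det M`
  -- survives; expanding the new matrix along its first row gives the other side.
  cramer : ∀ {n} (M : Matrix (suc n)) (v : Row (suc n)) →
    (∑ λ k → v k * M k zero) ≈ 1# → (∀ j → (∑ λ k → v k * M k (suc j)) ≈ 0#) →
    v zero * det M ≈ det (λ i j → M (suc i) (suc j))
  cramer M v vM₀≈1 vMⱼ≈0 = begin
    v zero * det M                            ≈⟨ *-congˡ (det-cong λ i j → sym (η-rows M i j)) ⟩
    v zero * det (M zero ∷ (M ∘ suc))         ≈⟨ +-identityʳ _ ⟨
    v zero * det (M zero ∷ (M ∘ suc)) + 0#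
      ≈⟨ +-congˡ (∑-zero λ k →
           trans (*-congˡ (repeated-head det-isAlternating (M (suc k)) (M ∘ suc) k λ _ → refl)) (zeroʳ _)) ⟨
    v zero * det (M zero ∷ (M ∘ suc)) + ∑ (λ k → v (suc k) * det (M (suc k) ∷ (M ∘ suc))) ≈⟨ ∑-suc _ ⟨
    ∑ (λ k → v k * det (M k ∷ (M ∘ suc)))     ≈⟨ linear-combination det-isAlternating v M (M ∘ suc) ⟨
    det ((λ j → ∑ λ k → v k * M k j) ∷ (M ∘ suc)) ≈⟨ det-lower ((λ j → ∑ λ k → v k * M k j) ∷ (M ∘ suc)) vMⱼ≈0 ⟩
    (∑ λ k → v k * M k zero) * det (λ i j → M (suc i) (suc j)) ≈⟨ *-congʳ vM₀≈1 ⟩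
    1# * det (λ i j → M (suc i) (suc j))      ≈⟨ *-identityˡ _ ⟩
    det (λ i j → M (suc i) (suc j))           ∎

  δ : ∀ {n} → Fin n → Fin n → Carrier
  δ i j = if eqFin i j then 1# else 0#

  scal : ∀ {n} → Carrier → Matrix n
  scal x i j = x * δ i j

  ∑-δ : ∀ {n} (i : Fin n) (f : Row n) → ∑ (λ k → δ i k * f k) ≈ f i
  ∑-δ zero f = trans (∑-suc _)
    (trans (+-cong (*-identityˡ _) (∑-zero λ k → zeroˡ _)) (+-identityʳ _))
  ∑-δ (suc i) f = trans (∑-suc _) (trans (+-cong (zeroˡ _) (∑-δ i (f ∘ suc))) (+-identityˡ _))

  scal-· : ∀ {n} x (M : Matrix n) i j → (scal x · M) i j ≈ x * M i j
  scal-· x M i j = begin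
    ∑ (λ k → x * δ i k * M k j)     ≈⟨ ∑-cong (λ k → *-assoc x _ _) ⟩
    ∑ (λ k → x * (δ i k * M k j))   ≈⟨ *-distribˡ-∑ x _ ⟨
    x * ∑ (λ k → δ i k * M k j)     ≈⟨ *-congˡ (∑-δ i (λ k → M k j)) ⟩
    x * M i j                       ∎

  ·-scal : ∀ {n} x (M : Matrix n) i j → (M · scal x) i j ≈ x * M i j
  ·-scal x M i j = begin
    ∑ (λ k → M i k * (x * δ k j))   ≈⟨ ∑-cong (λ k → x∙yz≈y∙xz _ x _) ⟩
    ∑ (λ k → x * (M i k * δ k j))   ≈⟨ *-distribˡ-∑ x _ ⟨
    x * ∑ (λ k → M i k * δ k j)     ≈⟨ *-congˡ (∑-cong λ k → trans (*-comm _ _) (*-congʳ (δ-sym k j))) ⟩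
    x * ∑ (λ k → δ j k * M i k)     ≈⟨ *-congˡ (∑-δ j (M i)) ⟩
    x * M i j                       ∎
    where
    δ-sym : ∀ {n} (i j : Fin n) → δ i j ≈ δ j i
    δ-sym i j = reflexive (≡.cong (if_then 1# else 0#) (eqFin-sym i j))

  det-scal : ∀ n x → det (scal {n} x) ≈ x ^ n
  det-scal zero    x = refl
  det-scal (suc n) x = trans (det-lower (scal x) λ j → zeroʳ x)
    (*-cong (*-identityʳ x) (det-scal n x))

  1^n≈1 : ∀ n → 1# ^ n ≈ 1#
  1^n≈1 zero    = refl
  1^n≈1 (suc n) = trans (*-identityˡ _) (1^n≈1 n)

  -- Block matrices

  blockEntry : ∀ {m n} → Matrix m → (Fin m → Fin n → Carrier) → (Fin n → Fin m → Carrier) → Matrix n →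
    Fin m ⊎ Fin n → Fin m ⊎ Fin n → Carrier
  blockEntry A B C D (inj₁ u) (inj₁ v) = A u v
  blockEntry A B C D (inj₁ u) (inj₂ v) = B u v
  blockEntry A B C D (inj₂ u) (inj₁ v) = C u v
  blockEntry A B C D (inj₂ u) (inj₂ v) = D u v

  block : ∀ {m n} → Matrix m → (Fin m → Fin n → Carrier) → (Fin n → Fin m → Carrier) → Matrix n →
    Matrix (m ℕ.+ n)
  block {m} A B C D i j = blockEntry A B C D (splitAt m i) (splitAt m j)

  block-cong : ∀ {m n} {A A′ : Matrix m} {B B′ : Fin m → Fin n → Carrier}
    {C C′ : Fin n → Fin m → Carrier} {D D′ : Matrix n} →
    (∀ i → A i ≋ A′ i) → (∀ i → B i ≋ B′ i) → (∀ i → C i ≋ C′ i) → (∀ i → D i ≋ D′ i) →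
    ∀ i → block A B C D i ≋ block A′ B′ C′ D′ i
  block-cong {m} p q r s i j with splitAt m i | splitAt m j
  ... | inj₁ u | inj₁ v = p u v
  ... | inj₁ u | inj₂ v = q u v
  ... | inj₂ u | inj₁ v = r u v
  ... | inj₂ u | inj₂ v = s u v

  block-tail : ∀ {m n} (A : Matrix (suc m)) (B : Fin (suc m) → Fin n → Carrier)
    (C : Fin n → Fin (suc m) → Carrier) D i j →
    block A B C D (suc i) (suc j) ≡
    block (λ u v → A (suc u) (suc v)) (λ u v → B (suc u) v) (λ u v → C u (suc v)) D i j
  block-tail {m} A B C D i j with splitAt m i | splitAt m j
  ... | inj₁ u | inj₁ v = ≡.refl
  ... | inj₁ u | inj₂ v = ≡.refl
  ... | inj₂ u | inj₁ v = ≡.refl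
  ... | inj₂ u | inj₂ v = ≡.refl

  𝟘 : ∀ {m n} → Fin m → Fin n → Carrier
  𝟘 _ _ = 0#

  det-block-lower : ∀ {m n} x (C : Fin n → Fin m → Carrier) (D : Matrix n) →
    det (block (scal x) 𝟘 C D) ≈ x ^ m * det D
  det-block-lower {zero}  x C D = sym (*-identityˡ _)
  det-block-lower {suc m} x C D = begin
    det (block (scal x) 𝟘 C D)
      ≈⟨ det-lower (block (scal x) 𝟘 C D) first-row ⟩
    x * 1# * det (λ i j → block (scal x) 𝟘 C D (suc i) (suc j))
      ≈⟨ *-cong (*-identityʳ x) (det-cong λ i j → reflexive (block-tail {m} (scal x) 𝟘 C D i j)) ⟩
    x * det (block (scal {m} x) 𝟘 (λ u v → C u (suc v)) D)
      ≈⟨ *-congˡ (det-block-lower {m} x _ D) ⟩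
    x * (x ^ m * det D) ≈⟨ *-assoc _ _ _ ⟨
    x ^ suc m * det D ∎
    where
    first-row : ∀ j → block (scal x) 𝟘 C D zero (suc j) ≈ 0#
    first-row j with splitAt m j
    ... | inj₁ v = zeroʳ x
    ... | inj₂ v = refl

  det-block-upper : ∀ {m n} x (B : Fin m → Fin n → Carrier) (D : Matrix n) →
    det (block (scal x) B 𝟘 D) ≈ x ^ m * det D
  det-block-upper {zero}  x B D = sym (*-identityˡ _)
  det-block-upper {suc m} x B D = begin
    det (block (scal x) B 𝟘 D)
      ≈⟨ det-upper (block (scal x) B 𝟘 D) first-column ⟩
    x * 1# * det (λ i j → block (scal x) B 𝟘 D (suc i) (suc j))
      ≈⟨ *-cong (*-identityʳ x) (det-cong λ i j → reflexive (block-tail {m} (scal x) B 𝟘 D i j)) ⟩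
    x * det (block (scal {m} x) (B ∘ suc) 𝟘 D)
      ≈⟨ *-congˡ (det-block-upper {m} x _ D) ⟩
    x * (x ^ m * det D) ≈⟨ *-assoc _ _ _ ⟨
    x ^ suc m * det D ∎
    where
    first-column : ∀ i → block (scal x) B 𝟘 D (suc i) zero ≈ 0#
    first-column i with splitAt m i
    ... | inj₁ u = zeroʳ x
    ... | inj₂ u = refl

  ∑-splitAt : ∀ m {n} (g : Fin m ⊎ Fin n → Carrier) →
    ∑ (λ i → g (splitAt m i)) ≈ ∑ (g ∘ inj₁) + ∑ (g ∘ inj₂)
  ∑-splitAt zero    g = sym (trans (+-congʳ (∑-empty _)) (+-identityˡ _))
  ∑-splitAt (suc m) g = begin
    ∑ (λ i → g (splitAt (suc m) i))                           ≈⟨ ∑-suc _ ⟩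
    g (inj₁ zero) + ∑ (λ i → g (Sum.map suc id (splitAt m i))) ≈⟨ +-congˡ (∑-splitAt m (g ∘ Sum.map suc id)) ⟩
    g (inj₁ zero) + (∑ (g ∘ inj₁ ∘ suc) + ∑ (g ∘ inj₂))       ≈⟨ +-assoc _ _ _ ⟨
    g (inj₁ zero) + ∑ (g ∘ inj₁ ∘ suc) + ∑ (g ∘ inj₂)         ≈⟨ +-congʳ (∑-suc _) ⟨
    ∑ (g ∘ inj₁) + ∑ (g ∘ inj₂)                               ∎

  infixl 6 _⊞_
  _⊞_ : ∀ {n} → Matrix n → Matrix n → Matrix n
  (M ⊞ N) i j = M i j + N i j

  block-· : ∀ {n} (A B C D A′ B′ C′ D′ : Matrix n) i j →
    (block A B C D · block A′ B′ C′ D′) i j ≈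
    block (A · A′ ⊞ B · C′) (A · B′ ⊞ B · D′) (C · A′ ⊞ D · C′) (C · B′ ⊞ D · D′) i j
  block-· {n} A B C D A′ B′ C′ D′ i j = trans
    (∑-splitAt n (λ k → blockEntry A B C D (splitAt n i) k * blockEntry A′ B′ C′ D′ k (splitAt n j)))
    (quadrant (splitAt n i) (splitAt n j))
    where
    quadrant : ∀ s s′ →
      ∑ (λ k → blockEntry A B C D s (inj₁ k) * blockEntry A′ B′ C′ D′ (inj₁ k) s′) +
      ∑ (λ k → blockEntry A B C D s (inj₂ k) * blockEntry A′ B′ C′ D′ (inj₂ k) s′) ≈
      blockEntry (A · A′ ⊞ B · C′) (A · B′ ⊞ B · D′) (C · A′ ⊞ D · C′) (C · B′ ⊞ D · D′) s s′
    quadrant (inj₁ u) (inj₁ v) = refl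
    quadrant (inj₁ u) (inj₂ v) = refl
    quadrant (inj₂ u) (inj₁ v) = refl
    quadrant (inj₂ u) (inj₂ v) = refl

  𝟘-· : ∀ {n} (M : Matrix n) i j → (𝟘 · M) i j ≈ 0#
  𝟘-· M i j = ∑-zero λ k → zeroˡ _

  ·-𝟘 : ∀ {n} (M : Matrix n) i j → (M · 𝟘) i j ≈ 0#
  ·-𝟘 M i j = ∑-zero λ k → zeroʳ _

  scal-scal : ∀ {n} x y (i j : Fin n) → (scal x · scal y) i j ≈ scal (x * y) i j
  scal-scal x y i j = trans (scal-· x (scal y) i j) (sym (*-assoc _ _ _))

  -1*-1 : - 1# * - 1# ≈ 1#
  -1*-1 = trans (-1*x≈-x _) (-‿involutive _)

  -- (0 −I; I 0) = (I −I; 0 I) (I 0; I I) (I −I; 0 I).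
  det-symplectic : ∀ n → det (block {n} {n} 𝟘 (scal (- 1#)) (scal 1#) 𝟘) ≈ 1#
  det-symplectic n = begin
    det (block {n} {n} 𝟘 (scal (- 1#)) (scal 1#) 𝟘)  ≈⟨ det-cong factor₂ ⟨
    det (UL · U)                                 ≈⟨ det-· UL U ⟩
    det UL * det U                               ≈⟨ *-cong (trans (sym (det-cong factor₁)) (det-· U L)) detU ⟩
    det U * det L * 1#                           ≈⟨ *-identityʳ _ ⟩
    det U * det L                                ≈⟨ *-cong detU detL ⟩
    1# * 1#                                      ≈⟨ *-identityˡ _ ⟩
    1#                                           ∎
    where
    U L UL : Matrix (n ℕ.+ n)
    U = block {n} {n} (scal 1#) (scal (- 1#)) 𝟘 (scal 1#)
    L = block {n} {n} (scal 1#) 𝟘 (scal 1#) (scal 1#)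
    UL = block {n} {n} 𝟘 (scal (- 1#)) (scal 1#) (scal 1#)
    det-I : 1# ^ n * det (scal {n} 1#) ≈ 1#
    det-I = trans (*-cong (1^n≈1 n) (trans (det-scal n 1#) (1^n≈1 n))) (*-identityˡ _)
    detU : det U ≈ 1#
    detU = trans (det-block-upper {n} 1# _ _) det-I
    detL : det L ≈ 1#
    detL = trans (det-block-lower {n} 1# _ _) det-I
    1·1 : ∀ (i j : Fin n) → (scal 1# · scal 1#) i j ≈ scal 1# i j
    1·1 i j = trans (scal-scal _ _ i j) (*-congʳ (*-identityˡ _))
    1·-1 : ∀ (i j : Fin n) → (scal 1# · scal (- 1#)) i j ≈ scal (- 1#) i j
    1·-1 i j = trans (scal-scal _ _ i j) (*-congʳ (*-identityˡ _))
    -1·1 : ∀ (i j : Fin n) → (scal (- 1#) · scal 1#) i j ≈ scal (- 1#) i j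
    -1·1 i j = trans (scal-scal _ _ i j) (*-congʳ (*-identityʳ _))
    scal-1+-1 : ∀ (i j : Fin n) → scal 1# i j + scal (- 1#) i j ≈ 0#
    scal-1+-1 i j = trans (sym (distribʳ _ _ _)) (trans (*-congʳ (-‿inverseʳ _)) (zeroˡ _))
    factor₁ : ∀ i → (U · L) i ≋ UL i
    factor₁ i j = trans
      (block-· {n} (scal 1#) (scal (- 1#)) 𝟘 (scal 1#) (scal 1#) 𝟘 (scal 1#) (scal 1#) i j)
      (block-cong {n} {n}
      (λ u v → trans (+-cong (1·1 u v) (-1·1 u v)) (scal-1+-1 u v))
      (λ u v → trans (+-cong (·-𝟘 (scal 1#) u v) (-1·1 u v)) (+-identityˡ _))
      (λ u v → trans (+-cong (𝟘-· (scal 1#) u v) (1·1 u v)) (+-identityˡ _))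
      (λ u v → trans (+-cong (𝟘-· 𝟘 u v) (1·1 u v)) (+-identityˡ _)) i j)
    factor₂ : ∀ i → (UL · U) i ≋ block {n} {n} 𝟘 (scal (- 1#)) (scal 1#) 𝟘 i
    factor₂ i j = trans
      (block-· {n} 𝟘 (scal (- 1#)) (scal 1#) (scal 1#) (scal 1#) (scal (- 1#)) 𝟘 (scal 1#) i j)
      (block-cong {n} {n}
      (λ u v → trans (+-cong (𝟘-· (scal 1#) u v) (·-𝟘 (scal (- 1#)) u v)) (+-identityˡ _))
      (λ u v → trans (+-cong (𝟘-· (scal (- 1#)) u v) (-1·1 u v)) (+-identityˡ _))
      (λ u v → trans (+-cong (1·1 u v) (·-𝟘 (scal 1#) u v)) (+-identityʳ _))
      (λ u v → trans (+-comm _ _) (trans (+-cong (1·1 u v) (1·-1 u v)) (scal-1+-1 u v))) i j)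

  -- With t an indeterminate, the two block matrices are t I − K and I + t K for the adjacency
  -- matrix K = (A I; I 0) of the hairing; they are intertwined by Z and S.
  hairing-functional-equation : ∀ {n} t (A : Matrix n) →
    (- 1#) ^ n * det (block (λ i j → scal t i j + - A i j) (scal (- 1#)) (scal (- 1#)) (scal t)) ≈
    det (block (λ i j → scal 1# i j + t * A i j) (scal t) (scal t) (scal 1#))
  hairing-functional-equation {n} t A = begin
    (- 1#) ^ n * det M        ≈⟨ *-comm _ _ ⟩
    det M * (- 1#) ^ n        ≈⟨ *-congˡ (sym det-Z) ⟩
    det M * det Z             ≈⟨ det-· M Z ⟨
    det (M · Z)               ≈⟨ det-cong intertwine ⟩
    det (S · N)               ≈⟨ det-· S N ⟩
    det S * det N             ≈⟨ *-congʳ (det-symplectic n) ⟩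
    1# * det N                ≈⟨ *-identityˡ _ ⟩
    det N                     ∎
    where
    T T′ : Matrix n
    T i j = scal t i j + - A i j
    T′ i j = scal 1# i j + t * A i j
    M N Z S : Matrix (n ℕ.+ n)
    M = block {n} {n} T (scal (- 1#)) (scal (- 1#)) (scal t)
    N = block {n} {n} T′ (scal t) (scal t) (scal 1#)
    -- `Z` is S K for the adjacency matrix K, and K S K = -S. Hence (t I - K) S K = t S K + S = S (I
    -- + t K).
    Z = block {n} {n} (scal (- 1#)) 𝟘 A (scal 1#)
    S = block {n} {n} 𝟘 (scal (- 1#)) (scal 1#) 𝟘
    det-Z : det Z ≈ (- 1#) ^ n
    det-Z = trans (det-block-lower (- 1#) A (scal 1#))
      (trans (*-congˡ (trans (det-scal n 1#) (1^n≈1 n))) (*-identityʳ _))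
    topLeft : ∀ u v → (T · scal (- 1#)) u v + (scal (- 1#) · A) u v ≈ 0# + - 1# * scal t u v
    topLeft u v = begin
      (T · scal (- 1#)) u v + (scal (- 1#) · A) u v ≈⟨ +-cong (·-scal _ T u v) (scal-· _ A u v) ⟩
      - 1# * T u v + - 1# * A u v                   ≈⟨ distribˡ _ _ _ ⟨
      - 1# * (scal t u v + - A u v + A u v)
        ≈⟨ *-congˡ (trans (+-assoc _ _ _) (trans (+-congˡ (-‿inverseˡ _)) (+-identityʳ _))) ⟩
      - 1# * scal t u v                             ≈⟨ +-identityˡ _ ⟨
      0# + - 1# * scal t u v                        ∎
    intertwine : ∀ i → (M · Z) i ≋ (S · N) i
    intertwine i j = trans (block-· {n} T (scal (- 1#)) (scal (- 1#)) (scal t) (scal (- 1#)) 𝟘 A (scal 1#) i j)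
      (trans (block-cong {n} {n}
      (λ u v → trans (topLeft u v) (sym (+-cong (𝟘-· T′ u v) (scal-· _ (scal t) u v))))
      (λ u v → +-congʳ (trans (·-𝟘 T u v) (sym (𝟘-· (scal t) u v))))
      (λ u v → trans (+-cong (trans (scal-scal _ _ u v) (*-congʳ -1*-1)) (scal-· t A u v))
        (sym (trans (+-cong (trans (scal-· 1# T′ u v) (*-identityˡ _)) (𝟘-· (scal t) u v)) (+-identityʳ _))))
      (λ u v → trans (+-cong (·-𝟘 (scal (- 1#)) u v) (trans (·-scal 1# (scal t) u v) (*-identityˡ _)))
        (trans (+-comm _ _) (sym (+-cong (trans (scal-· 1# (scal t) u v) (*-identityˡ _)) (𝟘-· (scal 1#) u v)))))
      i j)
      (sym (block-· {n} 𝟘 (scal (- 1#)) (scal 1#) 𝟘 T′ (scal t) (scal t) (scal 1#) i j)))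

  -- The second assumption says D M = N D for the diagonal matrix `D` of `d`. In an arbitrary ring
  -- `det D` need not be cancellable, but D² = I makes it its own inverse.
  det-sign-conjugate : ∀ {n} (d : Row n) (M N : Matrix n) →
    (∀ i → d i * d i ≈ 1#) → (∀ i j → d i * M i j ≈ d j * N i j) → det M ≈ det N
  det-sign-conjugate {n} d M N d²≈1 dM≈Nd = begin
    det M                       ≈⟨ *-identityˡ _ ⟨
    1# * det M                  ≈⟨ *-congʳ detD²≈1 ⟨
    det D * det D * det M       ≈⟨ *-assoc _ _ _ ⟩
    det D * (det D * det M)     ≈⟨ *-congˡ (det-· D M) ⟨
    det D * det (D · M)
      ≈⟨ *-congˡ (det-cong λ i j → trans (D-· M i j) (trans (dM≈Nd i j) (sym (·-D i j)))) ⟩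
    det D * det (N · D)         ≈⟨ *-congˡ (trans (det-· N D) (*-comm _ _)) ⟩
    det D * (det D * det N)     ≈⟨ *-assoc _ _ _ ⟨
    det D * det D * det N       ≈⟨ *-congʳ detD²≈1 ⟩
    1# * det N                  ≈⟨ *-identityˡ _ ⟩
    det N                       ∎
    where
    D : Matrix n
    D i j = d i * δ i j
    D-sym : ∀ {n} (d : Row n) i j → d i * δ i j ≈ d j * δ j i
    D-sym d zero    zero    = refl
    D-sym d zero    (suc j) = trans (zeroʳ _) (sym (zeroʳ _))
    D-sym d (suc i) zero    = trans (zeroʳ _) (sym (zeroʳ _))
    D-sym d (suc i) (suc j) = D-sym (d ∘ suc) i j
    D-· : ∀ K i j → (D · K) i j ≈ d i * K i j
    D-· K i j = trans (∑-cong λ k → *-assoc _ _ _)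
      (trans (sym (*-distribˡ-∑ (d i) _)) (*-congˡ (∑-δ i λ k → K k j)))
    ·-D : ∀ i j → (N · D) i j ≈ d j * N i j
    ·-D i j = begin
      ∑ (λ k → N i k * (d k * δ k j))   ≈⟨ ∑-cong (λ k → trans (*-congˡ (D-sym d k j)) (*-comm _ _)) ⟩
      ∑ (λ k → d j * δ j k * N i k)     ≈⟨ ∑-cong (λ k → *-assoc _ _ _) ⟩
      ∑ (λ k → d j * (δ j k * N i k))   ≈⟨ *-distribˡ-∑ (d j) _ ⟨
      d j * ∑ (λ k → δ j k * N i k)     ≈⟨ *-congˡ (∑-δ j (N i)) ⟩
      d j * N i j                       ∎
    detD²≈1 : det D * det D ≈ 1#
    detD²≈1 = trans (sym (det-· D D)) (trans
      (det-cong λ i j → trans (D-· D i j) (trans (sym (*-assoc _ _ _)) (*-congʳ (d²≈1 i))))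
      (trans (det-scal n 1#) (1^n≈1 n)))

-- Formal power series over ℤ

import Algebra.Construct.Pointwise as Pointwise
import Data.Bool.Properties as Bool
open import Data.Bool.Solver using (module xor-∧-Solver)
open import Data.Integer as ℤ using (ℤ; 0ℤ; 1ℤ; -1ℤ; _+_; _*_; -_; _≤_; ∣_∣)
import Data.Integer.Properties as ℤ
open import Data.Integer.Tactic.RingSolver using (solve-∀)
open import Data.List using (List; []; _∷_; allFin; cartesianProduct)
open import Data.List.Membership.Propositional using (_∈_)
open import Data.List.Membership.Propositional.Properties using (∈-cartesianProduct⁺; ∈-allFin)
open import Data.List.Relation.Unary.Any using (here; there)
import Data.Nat.Properties as ℕ
open import Data.Product.Function.NonDependent.Propositional using (_×-⇔_)
open import Function.Construct.Composition using (_⇔-∘_)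
open import Function.Construct.Identity using (⇔-id)
open import Relation.Nullary using (yes; no)
open ≡ using (_≗_; refl; sym; trans; cong; cong₂; subst; subst₂; module ≡-Reasoning)

Series : Set
Series = ℕ → ℤ

infixl 7 _⊛_
-- The Cauchy product, by the same recursion on the first factor as the list product `_⊗_`.
_⊛_ : Series → Series → Series
(f ⊛ g) zero    = f 0 * g 0
(f ⊛ g) (suc n) = f 0 * g (suc n) + ((f ∘ suc) ⊛ g) n

⊛-cong : ∀ {f f′ g g′ : Series} → f ≗ f′ → g ≗ g′ → f ⊛ g ≗ f′ ⊛ g′
⊛-cong p q zero    = cong₂ _*_ (p 0) (q 0)
⊛-cong p q (suc n) = cong₂ _+_ (cong₂ _*_ (p 0) (q (suc n))) (⊛-cong (p ∘ suc) q n)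

⊛-zeroˡ : ∀ g → (λ _ → 0ℤ) ⊛ g ≗ λ _ → 0ℤ
⊛-zeroˡ g zero    = refl
⊛-zeroˡ g (suc n) = trans (ℤ.+-identityˡ _) (⊛-zeroˡ g n)

⊛-scaleˡ : ∀ c f g → (λ k → c * f k) ⊛ g ≗ λ k → c * (f ⊛ g) k
⊛-scaleˡ c f g zero    = ℤ.*-assoc c _ _
⊛-scaleˡ c f g (suc n) = trans (cong₂ _+_ (ℤ.*-assoc c _ _) (⊛-scaleˡ c (f ∘ suc) g n))
  (sym (ℤ.*-distribˡ-+ c _ _))

⊛-distribʳ : ∀ h f g → (λ k → f k + g k) ⊛ h ≗ λ k → (f ⊛ h) k + (g ⊛ h) k
⊛-distribʳ h f g zero    = ℤ.*-distribʳ-+ (h 0) (f 0) (g 0)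
⊛-distribʳ h f g (suc n) = trans (cong ((f 0 + g 0) * h (suc n) +_) (⊛-distribʳ h (f ∘ suc) (g ∘ suc) n))
  (regroup (f 0) (g 0) (h (suc n)) (((f ∘ suc) ⊛ h) n) (((g ∘ suc) ⊛ h) n))
  where
  regroup : ∀ a b c x y → (a + b) * c + (x + y) ≡ a * c + x + (b * c + y)
  regroup = solve-∀

⊛-sucʳ : ∀ f g n → (f ⊛ g) (suc n) ≡ (f ⊛ (g ∘ suc)) n + f (suc n) * g 0
⊛-sucʳ f g zero    = refl
⊛-sucʳ f g (suc n) = trans (cong (f 0 * g (suc (suc n)) +_) (⊛-sucʳ (f ∘ suc) g n))
  (sym (ℤ.+-assoc (f 0 * g (suc (suc n))) _ _))

⊛-comm : ∀ f g → f ⊛ g ≗ g ⊛ f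
⊛-comm f g zero    = ℤ.*-comm (f 0) (g 0)
⊛-comm f g (suc n) = begin
  f 0 * g (suc n) + ((f ∘ suc) ⊛ g) n  ≡⟨ cong₂ _+_ (ℤ.*-comm (f 0) _) (⊛-comm (f ∘ suc) g n) ⟩
  g (suc n) * f 0 + (g ⊛ (f ∘ suc)) n  ≡⟨ ℤ.+-comm _ ((g ⊛ (f ∘ suc)) n) ⟩
  (g ⊛ (f ∘ suc)) n + g (suc n) * f 0  ≡⟨ ⊛-sucʳ g f n ⟨
  (g ⊛ f) (suc n)                      ∎
  where open ≡-Reasoning

⊛-assoc : ∀ f g h → (f ⊛ g) ⊛ h ≗ f ⊛ (g ⊛ h)
⊛-assoc f g h zero    = ℤ.*-assoc (f 0) (g 0) (h 0)
⊛-assoc f g h (suc n) = begin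
  f 0 * g 0 * h (suc n) + ((λ k → f 0 * g (suc k) + ((f ∘ suc) ⊛ g) k) ⊛ h) n
    ≡⟨ cong (f 0 * g 0 * h (suc n) +_) (⊛-distribʳ h (λ k → f 0 * g (suc k)) ((f ∘ suc) ⊛ g) n) ⟩
  f 0 * g 0 * h (suc n) + (((λ k → f 0 * g (suc k)) ⊛ h) n + (((f ∘ suc) ⊛ g) ⊛ h) n)
    ≡⟨ cong (f 0 * g 0 * h (suc n) +_) (cong₂ _+_ (⊛-scaleˡ (f 0) (g ∘ suc) h n) (⊛-assoc (f ∘ suc) g h n)) ⟩
  f 0 * g 0 * h (suc n) + (f 0 * ((g ∘ suc) ⊛ h) n + ((f ∘ suc) ⊛ (g ⊛ h)) n)
    ≡⟨ regroup (f 0) (g 0) (h (suc n)) (((g ∘ suc) ⊛ h) n) (((f ∘ suc) ⊛ (g ⊛ h)) n) ⟩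
  f 0 * (g 0 * h (suc n) + ((g ∘ suc) ⊛ h) n) + ((f ∘ suc) ⊛ (g ⊛ h)) n ∎
  where
  open ≡-Reasoning
  regroup : ∀ a b c x y → a * b * c + (a * x + y) ≡ a * (b * c + x) + y
  regroup = solve-∀

constant : ℤ → Series
constant c zero    = c
constant c (suc n) = 0ℤ

constant-⊛ : ∀ c g → constant c ⊛ g ≗ λ k → c * g k
constant-⊛ c g zero    = refl
constant-⊛ c g (suc n) = trans (cong (c * g (suc n) +_) (⊛-zeroˡ g n)) (ℤ.+-identityʳ _)

⊛-identityˡ : ∀ g → constant 1ℤ ⊛ g ≗ g
⊛-identityˡ g k = trans (constant-⊛ 1ℤ g k) (ℤ.*-identityˡ (g k))

series : CommutativeRing 0ℓ 0ℓ
series = record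
  { Carrier = Series ; _≈_ = _≗_ ; _+_ = λ f g k → f k + g k ; _*_ = _⊛_ ; -_ = λ f k → - f k
  ; 0# = λ _ → 0ℤ ; 1# = constant 1ℤ
  ; isCommutativeRing = record
    { isRing = record
      { +-isAbelianGroup = AbelianGroup.isAbelianGroup (Pointwise.abelianGroup ℕ ℤ.+-0-abelianGroup)
      ; *-cong = ⊛-cong
      ; *-assoc = ⊛-assoc
      ; *-identity = ⊛-identityˡ , λ f k → trans (⊛-comm f (constant 1ℤ) k) (⊛-identityˡ f k)
      ; distrib = (λ f g h k → trans (⊛-comm f (λ k → g k + h k) k) (trans (⊛-distribʳ f g h k)
          (cong₂ _+_ (⊛-comm g f k) (⊛-comm h f k)))) , ⊛-distribʳ
      }
    ; *-comm = ⊛-comm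
    }
  }

module D = Determinant series
open D using (Matrix; ∑; ∑-suc; ∑-empty; ∑-cong; sgn; minor; det; det-cong)
module R = CommutativeRing series
open import Algebra.Properties.Ring R.ring using () renaming (-1*x≈-x to -1⊛f≗-f)
open import Algebra.Properties.Semiring.Exp R.semiring using (_^_)
open import Algebra.Properties.CommutativeMonoid.Sum ℤ.+-0-commutativeMonoid
  using (sum; ∑-distrib-+; sum-cong-≗)

-- From coefficient lists to power series

coeff-⊕ : ∀ p q k → coeff (p ⊕ q) k ≡ coeff p k + coeff q k
coeff-⊕ []      q       k       = sym (ℤ.+-identityˡ _)
coeff-⊕ (x ∷ p) []      k       = sym (ℤ.+-identityʳ _)
coeff-⊕ (x ∷ p) (y ∷ q) zero    = refl
coeff-⊕ (x ∷ p) (y ∷ q) (suc k) = coeff-⊕ p q k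

coeff-scale : ∀ c p k → coeff (scale c p) k ≡ c * coeff p k
coeff-scale c []      k       = sym (ℤ.*-zeroʳ c)
coeff-scale c (x ∷ p) zero    = refl
coeff-scale c (x ∷ p) (suc k) = coeff-scale c p k

coeff-neg : ∀ p k → coeff (neg p) k ≡ - coeff p k
coeff-neg p k = trans (coeff-scale -1ℤ p k) (ℤ.-1*i≡-i _)

coeff-⊗ : ∀ p q → coeff (p ⊗ q) ≗ coeff p ⊛ coeff q
coeff-⊗ []      q k       = sym (⊛-zeroˡ (coeff q) k)
coeff-⊗ (x ∷ p) q zero    = trans (coeff-⊕ (scale x q) _ 0) (trans (ℤ.+-identityʳ _) (coeff-scale x q 0))
coeff-⊗ (x ∷ p) q (suc k) = trans (coeff-⊕ (scale x q) _ (suc k))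
  (cong₂ _+_ (coeff-scale x q (suc k)) (coeff-⊗ p q k))

coeff-sumFin : ∀ {n} (f : Fin n → Poly) → coeff (sumFin f) ≗ ∑ (λ i → coeff (f i))
coeff-sumFin {zero}  f k = sym (∑-empty _ k)
coeff-sumFin {suc n} f k = trans (coeff-⊕ (f zero) _ k)
  (trans (cong (coeff (f zero) k +_) (coeff-sumFin (f ∘ suc) k)) (sym (∑-suc _ k)))

iterNeg : ∀ {m} → Fin m → Poly → Poly
iterNeg zero p = p
iterNeg (suc j) p = neg (iterNeg j p)

sumFin-cong : ∀ {n} {f g : Fin n → Poly} → (∀ j → f j ≡ g j) → sumFin f ≡ sumFin g
sumFin-cong {zero} e = refl
sumFin-cong {suc n} e = cong₂ _⊕_ (e zero) (sumFin-cong (e ∘ suc))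

minorTerm : ∀ {n} → (Fin (suc n) → Fin (suc n) → Poly) → Fin (suc n) → Poly
minorTerm M j = M zero j ⊗ Defs.det (λ r c → M (suc r) (punchIn j c))

-- The function `sign` local to Defs.det cannot be named outside; here it is the solution of the
-- placeholder, which the clause of third-sign determines once every argument of it is a variable.
sign : ∀ n → (M : Fin (suc n) → Fin (suc n) → Poly) → ∀ {m} → Fin m → Poly → Poly
det-laplace : ∀ n M → Defs.det {suc n} M ≡ sumFin (λ j → iterNeg j (minorTerm M j))
third-sign : ∀ n (M : Fin (suc (suc n)) → Fin (suc (suc n)) → Poly) (i : Fin n) →
  _ ≡ iterNeg i (minorTerm M (suc (suc i)))
sign-iterNeg : ∀ n M {m} (j : Fin m) p → sign n M j p ≡ iterNeg j p

sign = _
det-laplace zero M = refl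
-- The local sign function computes on the first two columns and is stuck at `j` below two negations
-- on the others. Two columns are split off, not one, so that its size parameter `suc n` differs
-- from the bound `n` of `j` and can be generalised independently of it.
det-laplace (suc n) M = cong (λ z → minorTerm M zero ⊕ (neg (minorTerm M (suc zero)) ⊕ z))
  (sumFin-cong (λ j → cong (λ p → neg (neg p)) (third-sign n M j)))
third-sign n M j with minorTerm M (suc (suc j))
... | p with suc n
... | m = sign-iterNeg m M j p
sign-iterNeg n M zero p = refl
sign-iterNeg n M (suc j) p = cong neg (sign-iterNeg n M j p)

sgn-suc : ∀ {n} (j : Fin n) f → sgn (suc j) ⊛ f ≗ λ k → - (sgn j ⊛ f) k
sgn-suc j f k = trans (⊛-cong (λ k → sym (ℤ.-1*i≡-i (sgn j k))) (λ _ → refl) k)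
  (trans (⊛-scaleˡ -1ℤ (sgn j) f k) (ℤ.-1*i≡-i _))

coeff-iterNeg : ∀ {m} (j : Fin m) p → coeff (iterNeg j p) ≗ sgn j ⊛ coeff p
coeff-iterNeg zero    p k = sym (⊛-identityˡ (coeff p) k)
coeff-iterNeg (suc j) p k = trans (coeff-neg (iterNeg j p) k)
  (trans (cong -_ (coeff-iterNeg j p k)) (sym (sgn-suc j (coeff p) k)))

-- Transports the determinant of the statement into a commutative ring, where multiplicativity and
-- Cramer's rule apply.
coeff-det : ∀ {n} (M : Fin n → Fin n → Poly) → coeff (Defs.det M) ≗ det (λ i j → coeff (M i j))
coeff-det {zero}  M zero    = refl
coeff-det {zero}  M (suc k) = refl
coeff-det {suc n} M k = begin
  coeff (Defs.det M) k                                  ≡⟨ cong (λ p → coeff p k) (det-laplace n M) ⟩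
  coeff (sumFin λ j → iterNeg j (minorTerm M j)) k      ≡⟨ coeff-sumFin (λ j → iterNeg j (minorTerm M j)) k ⟩
  ∑ (λ j → coeff (iterNeg j (minorTerm M j))) k
    ≡⟨ ∑-cong (λ j → R.trans (coeff-iterNeg j (minorTerm M j)) (R.*-congˡ {sgn j}
      (R.trans (coeff-⊗ (M zero j) _)
        (R.*-congˡ {coeff (M zero j)} (coeff-det λ r c → M (suc r) (punchIn j c)))))) k ⟩
  det (λ i j → coeff (M i j)) k                         ∎
  where open ≡-Reasoning

-- Characteristic polynomials of graphs

linear : ℤ → ℤ → Series
linear x y zero          = x
linear x y (suc zero)    = y
linear x y (suc (suc k)) = 0ℤ

linear-⊛-suc : ∀ x y f k → (linear x y ⊛ f) (suc k) ≡ x * f (suc k) + y * f k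
linear-⊛-suc x y f k = cong (x * f (suc k) +_)
  (trans (⊛-cong tail≗ (λ _ → refl) k) (constant-⊛ y f k))
  where
  tail≗ : linear x y ∘ suc ≗ constant y
  tail≗ zero    = refl
  tail≗ (suc k) = refl

-- The matrix A + t B.
pencil : ∀ {n} → (A B : Fin n → Fin n → ℤ) → Matrix n
pencil A B i j = linear (A i j) (B i j)

-- Says that `g` is t^m f(1/t). The vanishing fields bound both degrees by `m`: multiplication by a
-- linear factor mixes neighbouring coefficients and so reads one place beyond the end.
record Reverse (m : ℕ) (f g : Series) : Set where
  field
    reverse  : ∀ i j → i ℕ.+ j ≡ m → f i ≡ g j
    vanishˡ  : ∀ k → f (suc m ℕ.+ k) ≡ 0ℤ
    vanishʳ  : ∀ k → g (suc m ℕ.+ k) ≡ 0ℤ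
open Reverse

Reverse-resp : ∀ {m f f′ g g′} → f ≗ f′ → g ≗ g′ → Reverse m f g → Reverse m f′ g′
Reverse-resp p q r = record
  { reverse = λ i j e → trans (sym (p i)) (trans (reverse r i j e) (q j))
  ; vanishˡ = λ k → trans (sym (p _)) (vanishˡ r k)
  ; vanishʳ = λ k → trans (sym (q _)) (vanishʳ r k)
  }

Reverse-zero : ∀ {m} → Reverse m (λ _ → 0ℤ) (λ _ → 0ℤ)
Reverse-zero = record { reverse = λ _ _ _ → refl ; vanishˡ = λ _ → refl ; vanishʳ = λ _ → refl }

Reverse-+ : ∀ {m f f′ g g′} → Reverse m f g → Reverse m f′ g′ →
  Reverse m (λ k → f k + f′ k) (λ k → g k + g′ k)
Reverse-+ r s = record
  { reverse = λ i j e → cong₂ _+_ (reverse r i j e) (reverse s i j e)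
  ; vanishˡ = λ k → cong₂ _+_ (vanishˡ r k) (vanishˡ s k)
  ; vanishʳ = λ k → cong₂ _+_ (vanishʳ r k) (vanishʳ s k)
  }

Reverse-neg : ∀ {m f g} → Reverse m f g → Reverse m (λ k → - f k) (λ k → - g k)
Reverse-neg r = record
  { reverse = λ i j e → cong -_ (reverse r i j e)
  ; vanishˡ = λ k → cong -_ (vanishˡ r k)
  ; vanishʳ = λ k → cong -_ (vanishʳ r k)
  }

Reverse-sgn : ∀ {n m f g} (j : Fin n) → Reverse m f g → Reverse m (sgn j ⊛ f) (sgn j ⊛ g)
Reverse-sgn zero    r = Reverse-resp (λ k → sym (⊛-identityˡ _ k)) (λ k → sym (⊛-identityˡ _ k)) r
Reverse-sgn (suc j) r =
  Reverse-resp (λ k → sym (sgn-suc j _ k)) (λ k → sym (sgn-suc j _ k)) (Reverse-neg (Reverse-sgn j r))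

Reverse-∑ : ∀ {n m} {f g : Fin n → Series} → (∀ i → Reverse m (f i) (g i)) → Reverse m (∑ f) (∑ g)
Reverse-∑ {zero}  r = Reverse-resp (λ k → sym (∑-empty _ k)) (λ k → sym (∑-empty _ k)) Reverse-zero
Reverse-∑ {suc n} r = Reverse-resp (λ k → sym (∑-suc _ k)) (λ k → sym (∑-suc _ k))
  (Reverse-+ (r zero) (Reverse-∑ (r ∘ suc)))

Reverse-linear : ∀ {m f g} x y → Reverse m f g → Reverse (suc m) (linear x y ⊛ f) (linear y x ⊛ g)
Reverse-linear {m} {f} {g} x y r = record
  { reverse = rev
  ; vanishˡ = λ k → trans (linear-⊛-suc x y f _)
      (vanish x y (trans (cong (f ∘ suc) (sym (ℕ.+-suc m k))) (vanishˡ r (suc k))) (vanishˡ r k))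
  ; vanishʳ = λ k → trans (linear-⊛-suc y x g _)
      (vanish y x (trans (cong (g ∘ suc) (sym (ℕ.+-suc m k))) (vanishʳ r (suc k))) (vanishʳ r k))
  }
  where
  open ≡-Reasoning
  vanish : ∀ x y {u v} → u ≡ 0ℤ → v ≡ 0ℤ → x * u + y * v ≡ 0ℤ
  vanish x y refl refl = cong₂ _+_ (ℤ.*-zeroʳ x) (ℤ.*-zeroʳ y)
  top : ∀ x y {u v w} → u ≡ 0ℤ → v ≡ w → x * u + y * v ≡ y * w
  top x y {v = v} refl refl = trans (cong (_+ y * v) (ℤ.*-zeroʳ x)) (ℤ.+-identityˡ _)
  rev : ∀ i j → i ℕ.+ j ≡ suc m → (linear x y ⊛ f) i ≡ (linear y x ⊛ g) j
  rev zero (suc j) e = sym (trans (linear-⊛-suc y x g j)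
    (top y x (trans (cong g (trans e (sym (ℕ.+-identityʳ _)))) (vanishʳ r 0))
      (sym (reverse r 0 j (ℕ.suc-injective e)))))
  rev (suc i) zero e = trans (linear-⊛-suc x y f i)
    (top x y (trans (cong f (trans (sym (ℕ.+-identityʳ _)) (trans e (sym (ℕ.+-identityʳ _))))) (vanishˡ r 0))
      (reverse r i 0 (ℕ.suc-injective e)))
  rev (suc i) (suc j) e = begin
    (linear x y ⊛ f) (suc i)   ≡⟨ linear-⊛-suc x y f i ⟩
    x * f (suc i) + y * f i
      ≡⟨ cong₂ (λ u v → x * u + y * v) 
           (reverse r (suc i) j (trans (sym (ℕ.+-suc i j)) i+sj≡m)) (reverse r i (suc j) i+sj≡m) ⟩
    x * g j + y * g (suc j)    ≡⟨ ℤ.+-comm (x * g j) _ ⟩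
    y * g (suc j) + x * g j    ≡⟨ linear-⊛-suc y x g j ⟨
    (linear y x ⊛ g) (suc j)   ∎
    where
    i+sj≡m : i ℕ.+ suc j ≡ m
    i+sj≡m = ℕ.suc-injective e

-- Reversal is multiplicative when the degree bounds add up. Each term of the expansion is a product
-- of n linear entries, so exchanging the two coefficients of every entry reverses the determinant.
det-pencil-reverse : ∀ {n} (A B : Fin n → Fin n → ℤ) → Reverse n (det (pencil A B)) (det (pencil B A))
det-pencil-reverse {zero} A B = record
  { reverse = λ { zero zero e → refl } ; vanishˡ = λ _ → refl ; vanishʳ = λ _ → refl }
det-pencil-reverse {suc n} A B = Reverse-∑ λ j → Reverse-sgn j (Reverse-linear (A zero j) (B zero j)
  (det-pencil-reverse (λ r c → A (suc r) (punchIn j c)) (λ r c → B (suc r) (punchIn j c))))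

-- The substitution t ↦ -t

sg : ℕ → ℤ
sg zero    = 1ℤ
sg (suc k) = - sg k

σ : Series → Series
σ f k = sg k * f k

σ-⊛ : ∀ f g → σ (f ⊛ g) ≗ σ f ⊛ σ g
σ-⊛ f g zero    = lemma (f 0) (g 0)
  where
  lemma : ∀ x y → 1ℤ * (x * y) ≡ 1ℤ * x * (1ℤ * y)
  lemma = solve-∀
σ-⊛ f g (suc n) = begin
  - sg n * (f 0 * g (suc n) + ((f ∘ suc) ⊛ g) n)
    ≡⟨ expand (sg n) (f 0) (g (suc n)) (((f ∘ suc) ⊛ g) n) ⟩
  1ℤ * f 0 * (- sg n * g (suc n)) + -1ℤ * σ ((f ∘ suc) ⊛ g) n
    ≡⟨ cong (λ z → 1ℤ * f 0 * (- sg n * g (suc n)) + -1ℤ * z) (σ-⊛ (f ∘ suc) g n) ⟩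
  1ℤ * f 0 * (- sg n * g (suc n)) + -1ℤ * (σ (f ∘ suc) ⊛ σ g) n
    ≡⟨ cong (1ℤ * f 0 * (- sg n * g (suc n)) +_) (⊛-scaleˡ -1ℤ (σ (f ∘ suc)) (σ g) n) ⟨
  1ℤ * f 0 * (- sg n * g (suc n)) + ((λ k → -1ℤ * σ (f ∘ suc) k) ⊛ σ g) n
    ≡⟨ cong (1ℤ * f 0 * (- sg n * g (suc n)) +_) (⊛-cong (λ k → shift (sg k) (f (suc k))) (λ _ → refl) n) ⟩
  (σ f ⊛ σ g) (suc n) ∎
  where
  open ≡-Reasoning
  expand : ∀ s x y z → - s * (x * y + z) ≡ 1ℤ * x * (- s * y) + -1ℤ * (s * z)
  expand = solve-∀
  shift : ∀ s x → -1ℤ * (s * x) ≡ - s * x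
  shift = solve-∀

σ-constant : ∀ c → σ (constant c) ≗ constant c
σ-constant c zero    = ℤ.*-identityˡ c
σ-constant c (suc k) = ℤ.*-zeroʳ (- sg k)

σ-∑ : ∀ {n} (f : Fin n → Series) → σ (∑ f) ≗ ∑ (λ i → σ (f i))
σ-∑ {zero}  f k = trans (cong (sg k *_) (∑-empty f k))
  (trans (ℤ.*-zeroʳ (sg k)) (sym (∑-empty (λ i → σ (f i)) k)))
σ-∑ {suc n} f k = begin
  sg k * ∑ f k                               ≡⟨ cong (sg k *_) (∑-suc f k) ⟩
  sg k * (f zero k + ∑ (f ∘ suc) k)          ≡⟨ ℤ.*-distribˡ-+ (sg k) _ _ ⟩
  σ (f zero) k + σ (∑ (f ∘ suc)) k           ≡⟨ cong (σ (f zero) k +_) (σ-∑ (f ∘ suc) k) ⟩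
  σ (f zero) k + ∑ (λ i → σ (f (suc i))) k   ≡⟨ ∑-suc (λ i → σ (f i)) k ⟨
  ∑ (λ i → σ (f i)) k                        ∎
  where open ≡-Reasoning

σ-sgn : ∀ {n} (j : Fin n) → σ (sgn j) ≗ sgn j
σ-sgn zero    k = σ-constant 1ℤ k
σ-sgn (suc j) k = trans (sym (ℤ.neg-distribʳ-* (sg k) _)) (cong -_ (σ-sgn j k))

-- `σ` is a ring endomorphism fixing the signs of the Laplace expansion, so it may be applied
-- entrywise.
σ-det : ∀ {n} (M : Matrix n) → σ (det M) ≗ det (λ i j → σ (M i j))
σ-det {zero}  M = σ-constant 1ℤ
σ-det {suc n} M = R.trans (σ-∑ _) (∑-cong λ j → R.trans (σ-⊛ (sgn j) (M zero j ⊛ det (minor M j)))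
  (R.*-cong (σ-sgn j) (R.trans (σ-⊛ (M zero j) (det (minor M j))) (R.*-congˡ {σ (M zero j)} (σ-det (minor M j))))))

adjacency : ∀ {n} → Graph n → Fin n → Fin n → ℤ
adjacency G i j = b2ℤ (adj G i j)

identity : ∀ {n} → Fin n → Fin n → ℤ
identity i j = b2ℤ (eqFin i j)

Q : ∀ {n} → Graph n → Series
Q G = det (pencil identity (λ i j → - adjacency G i j))

χ : ∀ {n} → Graph n → Series
χ G = coeff (charPoly G)

χ-pencil : ∀ {n} (G : Graph n) → χ G ≗ det (pencil (λ i j → - adjacency G i j) identity)
χ-pencil G k = trans (coeff-det (λ i j → (if eqFin i j then X else []) ⊕ neg (const (adjacency G i j))) k)
  (det-cong (λ i j → entry (eqFin i j) (adjacency G i j)) k)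
  where
  entry : ∀ e x → coeff ((if e then X else []) ⊕ neg (const x)) ≗ linear (- x) (b2ℤ e)
  entry true  x zero          = trans (ℤ.+-identityˡ _) (ℤ.-1*i≡-i x)
  entry true  x (suc zero)    = refl
  entry true  x (suc (suc k)) = refl
  entry false x zero          = ℤ.-1*i≡-i x
  entry false x (suc zero)    = refl
  entry false x (suc (suc k)) = refl

χ-reverse : ∀ {n} (G : Graph n) → Reverse n (χ G) (Q G)
χ-reverse G = Reverse-resp (λ k → sym (χ-pencil G k)) (λ _ → refl) (det-pencil-reverse _ _)

σQ : ∀ {n} (G : Graph n) → σ (Q G) ≗ det (pencil identity (adjacency G))
σQ G = R.trans (σ-det (pencil identity λ i j → - adjacency G i j))
  (det-cong λ i j → entry (identity i j) (adjacency G i j))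
  where
  entry : ∀ x y → σ (linear x (- y)) ≗ linear x y
  entry x y zero          = ℤ.*-identityˡ x
  entry x y (suc zero)    = trans (ℤ.-1*i≡-i (- y)) (ℤ.neg-involutive y)
  entry x y (suc (suc k)) = ℤ.*-zeroʳ (sg (suc (suc k)))

-- The hairing in block form

t : Series
t = linear 0ℤ 1ℤ

⊛-constant : ∀ f c → f ⊛ constant c ≗ λ k → c * f k
⊛-constant f c k = trans (⊛-comm f (constant c) k) (constant-⊛ c f k)

t⊛constant : ∀ c → t ⊛ constant c ≗ linear 0ℤ c
t⊛constant c k = trans (⊛-constant t c k) (entry k)
  where
  entry : ∀ k → c * t k ≡ linear 0ℤ c k
  entry zero          = ℤ.*-zeroʳ c
  entry (suc zero)    = ℤ.*-identityʳ c
  entry (suc (suc k)) = ℤ.*-zeroʳ c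

δ-constant : ∀ {n} (i j : Fin n) → D.δ i j ≗ constant (b2ℤ (eqFin i j))
δ-constant i j k with eqFin i j
δ-constant i j k       | true  = refl
δ-constant i j zero    | false = refl
δ-constant i j (suc k) | false = refl

t-scal : ∀ {n} (i j : Fin n) → D.scal t i j ≗ linear 0ℤ (b2ℤ (eqFin i j))
t-scal i j k = trans (⊛-cong (λ _ → refl) (δ-constant i j) k) (t⊛constant _ k)

linear-constant : ∀ x → linear x 0ℤ ≗ constant x
linear-constant x zero          = refl
linear-constant x (suc zero)    = refl
linear-constant x (suc (suc k)) = refl

1-scal : ∀ {n} (i j : Fin n) → D.scal R.1# i j ≗ linear (b2ℤ (eqFin i j)) 0ℤ
1-scal i j k = trans (⊛-identityˡ _ k) (trans (δ-constant i j k) (sym (linear-constant _ k)))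

-1-scal : ∀ {n} (i j : Fin n) → D.scal (R.- R.1#) i j ≗ linear (- b2ℤ (eqFin i j)) 0ℤ
-1-scal i j k = trans (-1⊛f≗-f (D.δ i j) k) (trans (cong -_ (δ-constant i j k))
  (trans (neg-constant (b2ℤ (eqFin i j)) k) (sym (linear-constant _ k))))
  where
  neg-constant : ∀ x k → - constant x k ≡ constant (- x) k
  neg-constant x zero    = refl
  neg-constant x (suc k) = refl

eqSum : ∀ {m n} → Fin m ⊎ Fin n → Fin m ⊎ Fin n → Bool
eqSum (inj₁ u) (inj₁ v) = eqFin u v
eqSum (inj₁ u) (inj₂ v) = false
eqSum (inj₂ u) (inj₁ v) = false
eqSum (inj₂ u) (inj₂ v) = eqFin u v

eqFin-splitAt : ∀ m {n} (i j : Fin (m ℕ.+ n)) → eqFin i j ≡ eqSum (splitAt m i) (splitAt m j)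
eqFin-splitAt zero    i       j       = refl
eqFin-splitAt (suc m) zero    zero    = refl
eqFin-splitAt (suc m) zero    (suc j) with splitAt m j
... | inj₁ v = refl
... | inj₂ v = refl
eqFin-splitAt (suc m) (suc i) zero    with splitAt m i
... | inj₁ u = refl
... | inj₂ u = refl
eqFin-splitAt (suc m) (suc i) (suc j) with splitAt m i | splitAt m j | eqFin-splitAt m i j
... | inj₁ u | inj₁ v | e = e
... | inj₁ u | inj₂ v | e = e
... | inj₂ u | inj₁ v | e = e
... | inj₂ u | inj₂ v | e = e

module _ {n : ℕ} (G : Graph n) where
  private
    A : Matrix n
    A i j = constant (adjacency G i j)
    M N : Matrix (n ℕ.+ n)
    M = D.block (λ i j → D.scal t i j R.+ (R.- A i j)) (D.scal (R.- R.1#)) (D.scal (R.- R.1#)) (D.scal t)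
    N = D.block (λ i j → D.scal R.1# i j R.+ t ⊛ A i j) (D.scal t) (D.scal t) (D.scal R.1#)

  χ-block : ∀ i j → linear (- adjacency (H G) i j) (identity i j) ≗ M i j
  -- Once `eqFin` is expressed through `splitAt`, matching on the two halves reduces the identity
  -- matrix, `hairAdj` and the block matrix together.
  χ-block i j k rewrite eqFin-splitAt n i j with splitAt n i | splitAt n j
  ... | inj₁ u | inj₂ v = sym (-1-scal u v k)
  ... | inj₂ u | inj₁ v = sym (-1-scal u v k)
  ... | inj₂ u | inj₂ v = sym (t-scal u v k)
  ... | inj₁ u | inj₁ v =
    trans (entry (adjacency G u v) (b2ℤ (eqFin u v)) k) (cong (_+ - A u v k) (sym (t-scal u v k)))
    where
    entry : ∀ x d k → linear (- x) d k ≡ linear 0ℤ d k + - constant x k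
    entry x d zero          = sym (ℤ.+-identityˡ _)
    entry x d (suc zero)    = sym (ℤ.+-identityʳ _)
    entry x d (suc (suc k)) = refl

  σQ-block : ∀ i j → linear (identity i j) (adjacency (H G) i j) ≗ N i j
  σQ-block i j k rewrite eqFin-splitAt n i j with splitAt n i | splitAt n j
  ... | inj₁ u | inj₂ v = sym (t-scal u v k)
  ... | inj₂ u | inj₁ v = sym (t-scal u v k)
  ... | inj₂ u | inj₂ v = sym (1-scal u v k)
  ... | inj₁ u | inj₁ v = trans (entry (b2ℤ (eqFin u v)) (adjacency G u v) k)
      (sym (cong₂ _+_ (1-scal u v k) (t⊛constant (adjacency G u v) k)))
    where
    entry : ∀ d x k → linear d x k ≡ linear d 0ℤ k + linear 0ℤ x k
    entry d x zero          = sym (ℤ.+-identityʳ _)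
    entry d x (suc zero)    = sym (ℤ.+-identityˡ _)
    entry d x (suc (suc k)) = refl

  χ-functional-equation : ∀ k → sg n * χ (H G) k ≡ sg k * Q (H G) k
  χ-functional-equation k = begin
    sg n * χ (H G) k                  ≡⟨ cong (sg n *_) (trans (χ-pencil (H G) k) (det-cong χ-block k)) ⟩
    sg n * det M k                    ≡⟨ [-1]^n⊛ n (det M) k ⟨
    ((R.- R.1#) ^ n ⊛ det M) k        ≡⟨ D.hairing-functional-equation t A k ⟩
    det N k                           ≡⟨ det-cong σQ-block k ⟨
    det (pencil identity (adjacency (H G))) k ≡⟨ σQ (H G) k ⟨
    sg k * Q (H G) k                  ∎
    where
    open ≡-Reasoning
    [-1]^n⊛ : ∀ n f → (R.- R.1#) ^ n ⊛ f ≗ λ k → sg n * f k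
    [-1]^n⊛ zero    f k = trans (⊛-identityˡ f k) (sym (ℤ.*-identityˡ (f k)))
    [-1]^n⊛ (suc n) f k = begin
      ((R.- R.1# ⊛ (R.- R.1#) ^ n) ⊛ f) k   ≡⟨ ⊛-assoc (R.- R.1#) ((R.- R.1#) ^ n) f k ⟩
      (R.- R.1# ⊛ ((R.- R.1#) ^ n ⊛ f)) k   ≡⟨ -1⊛f≗-f ((R.- R.1#) ^ n ⊛ f) k ⟩
      - ((R.- R.1#) ^ n ⊛ f) k              ≡⟨ cong -_ ([-1]^n⊛ n f k) ⟩
      - (sg n * f k)                        ≡⟨ ℤ.neg-distribˡ-* (sg n) (f k) ⟩
      - sg n * f k                          ∎

x≡-x⇒x≡0 : ∀ {x} → x ≡ - x → x ≡ 0ℤ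
x≡-x⇒x≡0 {ℤ.+ zero} e = refl

eqFin⇒≡ : ∀ {n} (i j : Fin n) → eqFin i j ≡ true → i ≡ j
eqFin⇒≡ zero    zero    e = refl
eqFin⇒≡ (suc i) (suc j) e = cong suc (eqFin⇒≡ i j e)

bipartite⇒Q-even : ∀ {n} (G : Graph n) → Bipartite G → Q G ≗ σ (Q G)
bipartite⇒Q-even {n} G (c , proper) = R.trans
  (D.det-sign-conjugate (λ i → constant (ε (c i)))
    (pencil identity (λ i j → - adjacency G i j)) (pencil identity (adjacency G))
    (λ i k → trans (constant-⊛ (ε (c i)) (constant (ε (c i))) k) (ε² (c i) k))
    λ i j k → trans (constant-⊛ (ε (c i)) (linear (identity i j) (- adjacency G i j)) k)
      (trans (entry i j k) (sym (constant-⊛ (ε (c j)) (linear (identity i j) (adjacency G i j)) k))))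
  (R.sym (σQ G))
  where
  ε : Bool → ℤ
  ε true  = 1ℤ
  ε false = -1ℤ
  ε² : ∀ b k → ε b * constant (ε b) k ≡ constant 1ℤ k
  ε² true  zero    = refl
  ε² true  (suc k) = refl
  ε² false zero    = refl
  ε² false (suc k) = refl
  opposite : ∀ b b′ → b ≢ b′ → ε b * -1ℤ ≡ ε b′ * 1ℤ
  opposite true  true  ne = ⊥-elim (ne refl)
  opposite true  false ne = refl
  opposite false true  ne = refl
  opposite false false ne = ⊥-elim (ne refl)
  entry : ∀ i j k →
    ε (c i) * linear (identity i j) (- adjacency G i j) k ≡ ε (c j) * linear (identity i j) (adjacency G i j) k
  entry i j zero with eqFin i j in e
  ... | true  = cong (λ i → ε (c i) * 1ℤ) (eqFin⇒≡ i j e)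
  ... | false = trans (ℤ.*-zeroʳ (ε (c i))) (sym (ℤ.*-zeroʳ (ε (c j))))
  entry i j (suc zero) with adj G i j in e
  ... | true  = opposite (c i) (c j) (proper i j e)
  ... | false = trans (ℤ.*-zeroʳ (ε (c i))) (sym (ℤ.*-zeroʳ (ε (c j))))
  entry i j (suc (suc k)) = trans (ℤ.*-zeroʳ (ε (c i))) (sym (ℤ.*-zeroʳ (ε (c j))))

-- Closed walks and 2-colourings

∑-coefficient : ∀ {n} (f : Fin n → Series) k → ∑ f k ≡ sum (λ i → f i k)
∑-coefficient {zero}  f k = ∑-empty f k
∑-coefficient {suc n} f k = trans (∑-suc f k) (cong (f zero k +_) (∑-coefficient (f ∘ suc) k))

sum-zero : ∀ {n} (f : Fin n → ℤ) → (∀ i → f i ≡ 0ℤ) → sum f ≡ 0ℤ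
sum-zero {zero}  f z = refl
sum-zero {suc n} f z = cong₂ _+_ (z zero) (sum-zero (f ∘ suc) (z ∘ suc))

sum-δ : ∀ {n} (j : Fin n) (f : Fin n → ℤ) → sum (λ i → b2ℤ (eqFin i j) * f i) ≡ f j
sum-δ zero    f = trans (cong₂ _+_ (ℤ.*-identityˡ (f zero)) (sum-zero (λ i → 0ℤ * f (suc i)) λ i → refl))
  (ℤ.+-identityʳ _)
sum-δ (suc j) f = trans (ℤ.+-identityˡ _) (sum-δ j (f ∘ suc))

sum-nonneg : ∀ {n} (f : Fin n → ℤ) → (∀ i → 0ℤ ≤ f i) → 0ℤ ≤ sum f
sum-nonneg {zero}  f p = ℤ.≤-refl
sum-nonneg {suc n} f p = ℤ.+-mono-≤ (p zero) (sum-nonneg (f ∘ suc) (p ∘ suc))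

≤-sum : ∀ {n} (f : Fin n → ℤ) → (∀ i → 0ℤ ≤ f i) → ∀ i → f i ≤ sum f
≤-sum f p zero    = subst (_≤ sum f) (ℤ.+-identityʳ (f zero))
  (ℤ.+-monoʳ-≤ (f zero) (sum-nonneg (f ∘ suc) (p ∘ suc)))
≤-sum f p (suc i) = subst (_≤ sum f) (ℤ.+-identityˡ (f (suc i)))
  (ℤ.+-mono-≤ (p zero) (≤-sum (f ∘ suc) (p ∘ suc) i))

*-nonneg : ∀ {x y} → 0ℤ ≤ x → 0ℤ ≤ y → 0ℤ ≤ x * y
*-nonneg {x} {y} 0≤x 0≤y = subst (_≤ x * y) (ℤ.*-zeroʳ x) (ℤ.*-monoˡ-≤-nonNeg x {{ℤ.nonNegative 0≤x}} 0≤y)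

b2ℤ-nonneg : ∀ b → 0ℤ ≤ b2ℤ b
b2ℤ-nonneg true  = ℤ.+≤+ ℕ.z≤n
b2ℤ-nonneg false = ℤ.+≤+ ℕ.z≤n

NonNegative : Series → Set
NonNegative f = ∀ k → 0ℤ ≤ f k

⊛-nonneg : ∀ {f g} → NonNegative f → NonNegative g → NonNegative (f ⊛ g)
⊛-nonneg p q zero    = *-nonneg (p 0) (q 0)
⊛-nonneg p q (suc k) = ℤ.+-mono-≤ (*-nonneg (p 0) (q (suc k))) (⊛-nonneg (p ∘ suc) q k)

-- The first term of the convolution is already `g k`, and all others are nonnegative.
≤-⊛ : ∀ {f g} → NonNegative f → NonNegative g → f 0 ≡ 1ℤ → ∀ k → g k ≤ (f ⊛ g) k
≤-⊛ {f} {g} p q f₀≡1 k = subst (_≤ (f ⊛ g) k) (trans (cong (_* g k) f₀≡1) (ℤ.*-identityˡ (g k))) (dominated k)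
  where
  dominated : ∀ k → f 0 * g k ≤ (f ⊛ g) k
  dominated zero    = ℤ.≤-refl
  dominated (suc k) = subst (_≤ (f ⊛ g) (suc k)) (ℤ.+-identityʳ _)
    (ℤ.+-monoʳ-≤ (f 0 * g (suc k)) (⊛-nonneg (p ∘ suc) q k))

delete : ∀ {n} → Graph (suc n) → Graph n
delete G = record
  { adj = λ u v → adj G (suc u) (suc v) ; sym = λ u v → Graph.sym G (suc u) (suc v)
  ; irrefl = λ u → irrefl G (suc u)
  }

-- Number of walks of a given length from the vertex zero to j.
walks : ∀ {n} → Graph (suc n) → Fin (suc n) → Series
walks G j zero    = b2ℤ (eqFin zero j)
walks G j (suc k) = sum λ i → walks G i k * adjacency G i j

-- The walk series form row zero of (I - tK)⁻¹ = I + tK + t²K² + ...: splitting off the last step of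
-- a walk cancels every coefficient but the constant one. This is the row `v` required by `cramer`.
walks-resolvent : ∀ {n} (G : Graph (suc n)) j →
  ∑ (λ i → walks G i ⊛ linear (identity i j) (- adjacency G i j)) ≗ constant (b2ℤ (eqFin zero j))
walks-resolvent G j zero = begin
  ∑ (λ i → walks G i ⊛ linear (identity i j) (- adjacency G i j)) 0 ≡⟨ ∑-coefficient _ 0 ⟩
  sum (λ i → walks G i 0 * identity i j)  ≡⟨ sum-cong-≗ (λ i → ℤ.*-comm (walks G i 0) (identity i j)) ⟩
  sum (λ i → identity i j * walks G i 0)  ≡⟨ sum-δ j (λ i → walks G i 0) ⟩
  b2ℤ (eqFin zero j)                        ∎
  where open ≡-Reasoning
walks-resolvent {n} G j (suc k) = begin
  ∑ (λ i → walks G i ⊛ linear (identity i j) (- adjacency G i j)) (suc k) ≡⟨ ∑-coefficient _ (suc k) ⟩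
  sum (λ i → (walks G i ⊛ linear (identity i j) (- adjacency G i j)) (suc k)) ≡⟨ sum-cong-≗ term ⟩
  sum f                     ≡⟨ ℤ.+-identityʳ (sum f) ⟨
  sum f + 0ℤ                ≡⟨ cong (sum f +_) (ℤ.+-inverseʳ (sum g)) ⟨
  sum f + (sum g + - sum g) ≡⟨ ℤ.+-assoc (sum f) (sum g) (- sum g) ⟨
  sum f + sum g + - sum g   ≡⟨ cong (_+ - sum g) (∑-distrib-+ f g) ⟨
  sum (λ i → f i + g i) + - sum g
    ≡⟨ cong (_+ - sum g) (sum-cong-≗ λ i →
      cancel (identity i j) (walks G i (suc k)) (adjacency G i j) (walks G i k)) ⟩
  sum (λ i → identity i j * walks G i (suc k)) + - sum g
    ≡⟨ cong (_+ - sum g) (sum-δ j λ i → walks G i (suc k)) ⟩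
  sum g + - sum g           ≡⟨ ℤ.+-inverseʳ (sum g) ⟩
  0ℤ                        ∎
  where
  open ≡-Reasoning
  f g : Fin (suc n) → ℤ
  f i = identity i j * walks G i (suc k) + - adjacency G i j * walks G i k
  g i = walks G i k * adjacency G i j
  term : ∀ i → (walks G i ⊛ linear (identity i j) (- adjacency G i j)) (suc k) ≡ f i
  term i = trans (⊛-comm (walks G i) _ (suc k)) (linear-⊛-suc (identity i j) (- adjacency G i j) (walks G i) k)
  cancel : ∀ d x a y → d * x + - a * y + y * a ≡ d * x
  cancel = solve-∀

closed-walks-⊛-Q : ∀ {n} (G : Graph (suc n)) → walks G zero ⊛ Q G ≗ Q (delete G)
closed-walks-⊛-Q G = D.cramer (pencil identity λ i j → - adjacency G i j) (walks G) (walks-resolvent G zero)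
  λ j k → trans (walks-resolvent G (suc j) k) (constant-0 k)
  where
  constant-0 : constant 0ℤ ≗ λ _ → 0ℤ
  constant-0 zero    = refl
  constant-0 (suc k) = refl

-- Defined as the product of closed-walk series over successive vertex deletions, which makes
-- nonnegativity evident; `Q⁻¹⊛Q` telescopes to show that it is the reciprocal.
Q⁻¹ : ∀ {n} → Graph n → Series
Q⁻¹ {zero}  G = constant 1ℤ
Q⁻¹ {suc n} G = walks G zero ⊛ Q⁻¹ (delete G)

Q⁻¹⊛Q : ∀ {n} (G : Graph n) → Q⁻¹ G ⊛ Q G ≗ constant 1ℤ
Q⁻¹⊛Q {zero}  G = ⊛-identityˡ (constant 1ℤ)
Q⁻¹⊛Q {suc n} G = begin
  walks G zero ⊛ Q⁻¹ (delete G) ⊛ Q G    ≈⟨ R.*-congʳ {Q G} (R.*-comm (walks G zero) (Q⁻¹ (delete G))) ⟩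
  Q⁻¹ (delete G) ⊛ walks G zero ⊛ Q G    ≈⟨ R.*-assoc (Q⁻¹ (delete G)) (walks G zero) (Q G) ⟩
  Q⁻¹ (delete G) ⊛ (walks G zero ⊛ Q G)  ≈⟨ R.*-congˡ {Q⁻¹ (delete G)} (closed-walks-⊛-Q G) ⟩
  Q⁻¹ (delete G) ⊛ Q (delete G)          ≈⟨ Q⁻¹⊛Q (delete G) ⟩
  constant 1ℤ                            ∎
  where open import Relation.Binary.Reasoning.Setoid R.setoid

walks-nonneg : ∀ {n} (G : Graph (suc n)) j → NonNegative (walks G j)
walks-nonneg G j zero    = b2ℤ-nonneg _
walks-nonneg G j (suc k) = sum-nonneg (λ i → walks G i k * adjacency G i j)
  λ i → *-nonneg (walks-nonneg G i k) (b2ℤ-nonneg _)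

Q⁻¹-nonneg : ∀ {n} (G : Graph n) → NonNegative (Q⁻¹ G)
Q⁻¹-nonneg {zero}  G zero    = ℤ.+≤+ ℕ.z≤n
Q⁻¹-nonneg {zero}  G (suc k) = ℤ.≤-refl
Q⁻¹-nonneg {suc n} G = ⊛-nonneg (walks-nonneg G zero) (Q⁻¹-nonneg (delete G))

Q⁻¹₀≡1 : ∀ {n} (G : Graph n) → Q⁻¹ G 0 ≡ 1ℤ
Q⁻¹₀≡1 {zero}  G = refl
Q⁻¹₀≡1 {suc n} G = cong (1ℤ *_) (Q⁻¹₀≡1 (delete G))

-- Parity of closed walks

odd : ℕ → Bool
odd zero    = false
odd (suc k) = not (odd k)

odd-+ : ∀ k l → odd (k ℕ.+ l) ≡ odd k xor odd l
odd-+ zero    l = refl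
odd-+ (suc k) l = trans (cong not (odd-+ k l)) (Bool.not-distribˡ-xor (odd k) (odd l))

OddFree : Series → Set
OddFree f = ∀ k → odd k ≡ true → f k ≡ 0ℤ

data Walk {n} (G : Graph n) (u : Fin n) : ℕ → Fin n → Set where
  nil  : Walk G u 0 u
  snoc : ∀ {k v w} → Walk G u k v → adj G v w ≡ true → Walk G u (suc k) w

infixl 5 _⧺_
_⧺_ : ∀ {n} {G : Graph n} {u v w k l} → Walk G u k v → Walk G v l w → Walk G u (l ℕ.+ k) w
p ⧺ nil      = p
p ⧺ snoc q e = snoc (p ⧺ q) e

walk⇒walks : ∀ {n} {G : Graph (suc n)} {k j} → Walk G zero k j → 1ℤ ≤ walks G j k
walk⇒walks nil = ℤ.≤-refl
walk⇒walks {G = G} (snoc {k} {v} {w} p e) = ℤ.≤-trans (walk⇒walks p)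
  (subst (_≤ walks G w (suc k))
    (trans (cong (λ b → walks G v k * b2ℤ b) e) (ℤ.*-identityʳ _))
    (≤-sum (λ i → walks G i k * adjacency G i w) (λ i → *-nonneg (walks-nonneg G i k) (b2ℤ-nonneg _)) v))

-- Mirrors the factorization of `Q⁻¹`: a walk either lives in the graph without vertex zero or is
-- cut at a visit to it. `route` cuts at the first visit.
data Route {n} (G : Graph (suc n)) : Fin (suc n) → ℕ → Fin (suc n) → Set where
  avoiding : ∀ {u k v} → Walk (delete G) u k v → Route G (suc u) k (suc v)
  through  : ∀ {u k l v} → Walk G u k zero → Walk G zero l v → Route G u (l ℕ.+ k) v

route : ∀ {n} {G : Graph (suc n)} {u k v} → Walk G u k v → Route G u k v
route {u = zero}  nil = through nil nil
route {u = suc u} nil = avoiding nil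
route {v = v} (snoc p e) with route p
route {v = v}     (snoc p e) | through q r = through q (snoc r e)
route {v = zero}  (snoc p e) | avoiding q  = through (snoc p e) nil
route {v = suc v} (snoc p e) | avoiding q  = avoiding (snoc q e)

no-odd-closed-walk : ∀ {n} (G : Graph n) → OddFree (Q⁻¹ G) → ∀ {u k} → Walk G u k u → odd k ≡ false
no-odd-closed-walk {suc n} G free p with route p
... | avoiding q = no-odd-closed-walk (delete G) free′ q
  where
  free′ : OddFree (Q⁻¹ (delete G))
  free′ k e = ℤ.≤-antisym
    (subst (Q⁻¹ (delete G) k ≤_) (free k e) (≤-⊛ (walks-nonneg G zero) (Q⁻¹-nonneg (delete G)) refl k))
    (Q⁻¹-nonneg (delete G) k)
... | through {k = k} {l} q r with odd (l ℕ.+ k) in e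
...   | false = refl
-- Rotating the closed walk to start at vertex zero gives `r ⧺ q`. It is counted by a coefficient of
-- `walks G zero`, which lies below the coefficient of `Q⁻¹ G` that vanishes by oddness.
...   | true  = ⊥-elim (1≰0 (ℤ.≤-trans (walk⇒walks (r ⧺ q)) (subst (walks G zero (k ℕ.+ l) ≤_)
          (free (k ℕ.+ l) (trans (cong odd (ℕ.+-comm k l)) e)) bound)))
  where
  1≰0 : 1ℤ ≤ 0ℤ → ⊥
  1≰0 (ℤ.+≤+ ())
  bound : walks G zero (k ℕ.+ l) ≤ Q⁻¹ G (k ℕ.+ l)
  bound = subst (walks G zero (k ℕ.+ l) ≤_) (⊛-comm (Q⁻¹ (delete G)) (walks G zero) (k ℕ.+ l))
    (≤-⊛ (Q⁻¹-nonneg (delete G)) (walks-nonneg G zero) (Q⁻¹₀≡1 (delete G)) (k ℕ.+ l))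

-- State of a union-find run over the list of pairs es: the classes of `root` are joined by
-- walks whose parity is read off the two colours.
record Merging {n} (G : Graph n) (es : List (Fin n × Fin n)) : Set where
  field
    root   : Fin n → Fin n
    colour : Fin n → Bool
    linked : ∀ x y → root x ≡ root y → ∃ λ k → Walk G x k y × odd k ≡ colour x xor colour y
    proper : ∀ {u v} → (u , v) ∈ es → adj G u v ≡ true → root u ≡ root v × colour u xor colour v ≡ true

module _ {n : ℕ} (G : Graph n) (no-odd : ∀ {u k} → Walk G u k u → odd k ≡ false) where
  merge : ∀ {es} u v → Merging G es → Merging G ((u , v) ∷ es)
  merge {es} u v S with adj G u v in uv
  ... | false = record
    { root = root ; colour = colour ; linked = linked
    ; proper = λ { (here refl) e → ⊥-elim (case trans (sym uv) e of λ ()) ; (there m) → proper m } }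
    where open Merging S
  ... | true with Merging.root S u Fin.≟ Merging.root S v
  ...   | yes same = record
    { root = root ; colour = colour ; linked = linked
    ; proper = λ { (here refl) _ → same , closed ; (there m) → proper m } }
    where
    open Merging S
    closed : colour u xor colour v ≡ true
    -- The linking walk from `v` to `u` closes up along the edge. The closed walk has even length,
    -- so the linking walk is odd and the colours already differ.
    closed with linked v u (sym same)
    ... | k , p , e = trans (Bool.xor-comm (colour u) (colour v))
      (trans (sym e) (Bool.not-injective (no-odd (snoc p uv))))
  ...   | no differ = record { root = root′ ; colour = colour′ ; linked = linked′ ; proper = proper′ }
    where
    open Merging S
    -- True exactly when `u` and `v` have equal colours; adding it throughout the class of `v` gives
    -- `v` the colour opposite to that of `u`.
    flip : Bool
    flip = not (colour u xor colour v)
    root′ : Fin n → Fin n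
    root′ x with root x Fin.≟ root v
    ... | yes _ = root u
    ... | no  _ = root x
    colour′ : Fin n → Bool
    colour′ x with root x Fin.≟ root v
    ... | yes _ = colour x xor flip
    ... | no  _ = colour x
    open xor-∧-Solver
    linked′ : ∀ x y → root′ x ≡ root′ y → ∃ λ k → Walk G x k y × odd k ≡ colour′ x xor colour′ y
    linked′ x y e with root x Fin.≟ root v | root y Fin.≟ root v
    ... | no  _  | no  _  = linked x y e
    ... | yes xv | yes yv with linked x y (trans xv (sym yv))
    ...   | k , p , o = k , p , trans o
      (solve 3 (λ a b f → a :+ b := (a :+ f) :+ (b :+ f)) refl (colour x) (colour y) flip)
    -- The joined classes are connected through the new edge: from `x` to `v`, across to `u`, on to
    -- `y`. The extra step is matched by the negation in `flip`.
    linked′ x y e | yes xv | no _ with linked x v xv | linked u y e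
    ...   | k , p , o | l , q , o′ = l ℕ.+ suc k , (snoc p (trans (Graph.sym G v u) uv) ⧺ q) ,
      trans (odd-+ l (suc k)) (trans (cong₂ (λ a b → a xor not b) o′ o)
      (solve 4 (λ a b c d → (c :+ b) :+ (con true :+ (a :+ d)) := (a :+ (con true :+ (c :+ d))) :+ b) refl
        (colour x) (colour y) (colour u) (colour v)))
    linked′ x y e | no _ | yes yv with linked x u e | linked v y (sym yv)
    ...   | k , p , o | l , q , o′ = l ℕ.+ suc k , (snoc p uv ⧺ q) ,
      trans (odd-+ l (suc k)) (trans (cong₂ (λ a b → a xor not b) o′ o)
      (solve 4 (λ a b c d → (d :+ b) :+ (con true :+ (a :+ c)) := a :+ (b :+ (con true :+ (c :+ d)))) refl
        (colour x) (colour y) (colour u) (colour v)))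
    proper′ : ∀ {x y} → (x , y) ∈ (u , v) ∷ es → adj G x y ≡ true →
      root′ x ≡ root′ y × colour′ x xor colour′ y ≡ true
    proper′ (here refl) _ with root u Fin.≟ root v | root v Fin.≟ root v
    ... | yes same | _     = ⊥-elim (differ same)
    ... | no _     | no ne = ⊥-elim (ne refl)
    ... | no _     | yes _ = refl ,
      solve 2 (λ c d → c :+ (d :+ (con true :+ (c :+ d))) := con true) refl (colour u) (colour v)
    proper′ {x} {y} (there m) e with proper m e
    ... | rx≡ry , cx≢cy with root x Fin.≟ root v | root y Fin.≟ root v
    ...   | no  _  | no  _  = rx≡ry , cx≢cy
    ...   | yes _  | yes _  = refl ,
      trans (solve 3 (λ a b f → (a :+ f) :+ (b :+ f) := a :+ b) refl (colour x) (colour y) flip) cx≢cy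
    ...   | yes xv | no  ny = ⊥-elim (ny (trans (sym rx≡ry) xv))
    ...   | no  nx | yes yv = ⊥-elim (nx (trans rx≡ry yv))

  merge-all : ∀ es → Merging G es
  merge-all [] = record
    { root = λ x → x ; colour = λ _ → false
    ; linked = λ { x .x refl → 0 , nil , refl } ; proper = λ () }
  merge-all ((u , v) ∷ es) = merge u v (merge-all es)

  bipartite : Bipartite G
  bipartite = colour , λ u v e cu≡cv →
    case trans (sym (proj₂ (proper (∈-cartesianProduct⁺ (∈-allFin u) (∈-allFin v)) e)))
      (trans (cong (_xor colour v) cu≡cv) (Bool.xor-same (colour v))) of λ ()
    where open Merging (merge-all (cartesianProduct (allFin n) (allFin n)))

-- Bipartiteness as evenness of `Q`

signOf : Bool → ℤ
signOf true  = -1ℤ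
signOf false = 1ℤ

sg-odd : ∀ k → sg k ≡ signOf (odd k)
sg-odd zero    = refl
sg-odd (suc k) = trans (cong -_ (sg-odd k)) (neg-signOf (odd k))
  where
  neg-signOf : ∀ b → - signOf b ≡ signOf (not b)
  neg-signOf true  = refl
  neg-signOf false = refl

σ-fixed⇒OddFree : ∀ {f} → f ≗ σ f → OddFree f
σ-fixed⇒OddFree {f} even k e = x≡-x⇒x≡0 (trans (even k)
  (trans (cong (_* f k) (trans (sg-odd k) (cong signOf e))) (ℤ.-1*i≡-i (f k))))

OddFree⇒σ-fixed : ∀ {f} → OddFree f → f ≗ σ f
OddFree⇒σ-fixed {f} free k with odd k in e
... | true  = trans (free k e) (sym (trans (cong (sg k *_) (free k e)) (ℤ.*-zeroʳ (sg k))))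
... | false = sym (trans (cong (_* f k) (trans (sg-odd k) (cong signOf e))) (ℤ.*-identityˡ (f k)))

-- Uniqueness of inverses: `σ` is multiplicative, so `σ (Q⁻¹ G)` is an inverse of `σ (Q G)`, that
-- is, of `Q G`.
Q-even⇒Q⁻¹-even : ∀ {n} (G : Graph n) → Q G ≗ σ (Q G) → Q⁻¹ G ≗ σ (Q⁻¹ G)
Q-even⇒Q⁻¹-even G even = begin
  Q⁻¹ G                        ≈⟨ ⊛-identityˡ (Q⁻¹ G) ⟨
  constant 1ℤ ⊛ Q⁻¹ G
    ≈⟨ R.*-congʳ {Q⁻¹ G} (R.trans (R.sym (σ-constant 1ℤ)) (λ k → cong (sg k *_) (sym (Q⁻¹⊛Q G k)))) ⟩
  σ (Q⁻¹ G ⊛ Q G) ⊛ Q⁻¹ G      ≈⟨ R.*-congʳ {Q⁻¹ G} (σ-⊛ (Q⁻¹ G) (Q G)) ⟩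
  σ (Q⁻¹ G) ⊛ σ (Q G) ⊛ Q⁻¹ G  ≈⟨ R.*-congʳ {Q⁻¹ G} (R.*-congˡ {σ (Q⁻¹ G)} even) ⟨
  σ (Q⁻¹ G) ⊛ Q G ⊛ Q⁻¹ G      ≈⟨ R.*-assoc (σ (Q⁻¹ G)) (Q G) (Q⁻¹ G) ⟩
  σ (Q⁻¹ G) ⊛ (Q G ⊛ Q⁻¹ G)    ≈⟨ R.*-congˡ {σ (Q⁻¹ G)} (R.trans (R.*-comm (Q G) (Q⁻¹ G)) (Q⁻¹⊛Q G)) ⟩
  σ (Q⁻¹ G) ⊛ constant 1ℤ      ≈⟨ R.*-identityʳ (σ (Q⁻¹ G)) ⟩
  σ (Q⁻¹ G)                    ∎
  where open import Relation.Binary.Reasoning.Setoid R.setoid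

bipartite⇔OddFree-Q : ∀ {n} (G : Graph n) → Bipartite G ⇔ OddFree (Q G)
bipartite⇔OddFree-Q G = mk⇔ (σ-fixed⇒OddFree ∘ bipartite⇒Q-even G)
  λ free → bipartite G (no-odd-closed-walk G (σ-fixed⇒OddFree (Q-even⇒Q⁻¹-even G (OddFree⇒σ-fixed free))))

Q₀≡1 : ∀ {n} (G : Graph n) → Q G 0 ≡ 1ℤ
Q₀≡1 G = begin
  Q G 0                ≡⟨ ℤ.*-identityˡ (Q G 0) ⟨
  1ℤ * Q G 0           ≡⟨ cong (_* Q G 0) (Q⁻¹₀≡1 G) ⟨
  Q⁻¹ G 0 * Q G 0      ≡⟨ Q⁻¹⊛Q G 0 ⟩
  1ℤ                   ∎
  where open ≡-Reasoning

odd-double : ∀ k → odd (k ℕ.+ k) ≡ false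
odd-double k = trans (odd-+ k k) (Bool.xor-same (odd k))

even⇔ : ∀ n → odd n ≡ false ⇔ Even n
odd⇔ : ∀ n → odd n ≡ true ⇔ Odd n
even⇔ n = mk⇔ (to n) λ { (k , refl) → odd-double k }
  where
  to : ∀ n → odd n ≡ false → Even n
  to zero    e = 0 , refl
  to (suc n) e with Equivalence.to (odd⇔ n) (Bool.not-injective e)
  ... | k , refl = suc k , cong suc (sym (ℕ.+-suc k k))
odd⇔ n = mk⇔ (to n) λ { (k , refl) → cong not (odd-double k) }
  where
  to : ∀ n → odd n ≡ true → Odd n
  to (suc n) e with Equivalence.to (even⇔ n) (Bool.not-injective e)
  ... | k , refl = k , refl

-- Coefficient symmetries of the hairing

module _ (n : ℕ) (G : Graph n) where
  private
    m : ℕ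
    m = n ℕ.+ n

  χ-reflect : ∀ {i} → i ℕ.≤ m → χ (H G) (m ℕ.∸ i) ≡ Q (H G) i
  χ-reflect {i} i≤m = Reverse.reverse (χ-reverse (H G)) (m ℕ.∸ i) i (ℕ.m∸n+n≡m i≤m)

  functional-equation : ∀ i → signOf (odd n) * χ (H G) i ≡ signOf (odd i) * Q (H G) i
  functional-equation i = subst₂ (λ x y → x * χ (H G) i ≡ y * Q (H G) i) (sg-odd n) (sg-odd i)
    (χ-functional-equation G i)

  -- One Boolean covers both symmetries: `false` carries the sign of palindromic, `true` that of
  -- antipalindromic.
  Reciprocal : Bool → Set
  Reciprocal b = ∀ i → i ℕ.≤ m → χ (H G) (m ℕ.∸ i) ≡ signOf b * χ (H G) i

  -- By `χ-reflect` reciprocity compares Q with (-1)^b χ, while the functional equation gives (-1)ⁿ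
  -- χ = Q(-t). At index zero Q is 1, which forces b to be the parity of n; then Q and Q(-t) agree,
  -- which is bipartiteness.
  reciprocal⇔ : ∀ b → Reciprocal b ⇔ (Bipartite (H G) × odd n ≡ b)
  reciprocal⇔ b = mk⇔ to from
    where
    parity : ∀ b b′ {x} → signOf b * x ≡ 1ℤ → signOf b′ * x ≡ 1ℤ → b ≡ b′
    parity true  true  p q = refl
    parity false false p q = refl
    parity true  false {x} p q with trans (sym (ℤ.*-identityˡ x)) q
    parity true  false {x} () q | refl
    parity false true  {x} p q with trans (sym (ℤ.*-identityˡ x)) p
    parity false true  {x} p () | refl

    to : Reciprocal b → Bipartite (H G) × odd n ≡ b
    to rec = Equivalence.from (bipartite⇔OddFree-Q (H G)) free , odd-n
      where
      odd-n : odd n ≡ b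
      odd-n = parity (odd n) b
        (trans (functional-equation 0) (trans (ℤ.*-identityˡ _) (Q₀≡1 (H G))))
        (trans (sym (rec 0 ℕ.z≤n)) (trans (χ-reflect {0} ℕ.z≤n) (Q₀≡1 (H G))))
      free : OddFree (Q (H G))
      free k e with k ℕ.≤? m
      ... | yes k≤m = x≡-x⇒x≡0 (begin
        Q (H G) k                       ≡⟨ χ-reflect k≤m ⟨
        χ (H G) (m ℕ.∸ k)               ≡⟨ rec k k≤m ⟩
        signOf b * χ (H G) k            ≡⟨ cong (λ b → signOf b * χ (H G) k) odd-n ⟨
        signOf (odd n) * χ (H G) k      ≡⟨ functional-equation k ⟩
        signOf (odd k) * Q (H G) k      ≡⟨ cong (λ b → signOf b * Q (H G) k) e ⟩
        -1ℤ * Q (H G) k                 ≡⟨ ℤ.-1*i≡-i (Q (H G) k) ⟩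
        - Q (H G) k                     ∎)
        where open ≡-Reasoning
      -- Reciprocity says nothing beyond index `m`; there the degree bound makes the coefficient
      -- vanish.
      ... | no k≰m = subst (λ k → Q (H G) k ≡ 0ℤ) (ℕ.m+[n∸m]≡n (ℕ.≰⇒> k≰m))
        (Reverse.vanishʳ (χ-reverse (H G)) (k ℕ.∸ suc m))

    from : Bipartite (H G) × odd n ≡ b → Reciprocal b
    from (bip , refl) i i≤m = trans (χ-reflect i≤m) (trans Q≡ (sym (functional-equation i)))
      where
      Q≡ : Q (H G) i ≡ signOf (odd i) * Q (H G) i
      Q≡ with odd i in e
      ... | false = sym (ℤ.*-identityˡ _)
      ... | true  = trans Q≡0 (sym (cong (-1ℤ *_) Q≡0))
        where
        Q≡0 : Q (H G) i ≡ 0ℤ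
        Q≡0 = Equivalence.to (bipartite⇔OddFree-Q (H G)) bip i e

  absPalindromic : AbsPalindromic (H G)
  absPalindromic i i≤m = begin
    ∣ χ (H G) (m ℕ.∸ i) ∣                ≡⟨ cong ∣_∣ (χ-reflect i≤m) ⟩
    ∣ Q (H G) i ∣                        ≡⟨ ∣signOf*∣ (odd i) _ ⟨
    ∣ signOf (odd i) * Q (H G) i ∣       ≡⟨ cong ∣_∣ (functional-equation i) ⟨
    ∣ signOf (odd n) * χ (H G) i ∣       ≡⟨ ∣signOf*∣ (odd n) _ ⟩
    ∣ χ (H G) i ∣                        ≡⟨ cong (λ k → ∣ χ (H G) k ∣) (ℕ.m∸[m∸n]≡n i≤m) ⟨
    ∣ χ (H G) (m ℕ.∸ (m ℕ.∸ i)) ∣        ∎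
    where
    open ≡-Reasoning
    ∣signOf*∣ : ∀ b x → ∣ signOf b * x ∣ ≡ ∣ x ∣
    ∣signOf*∣ true  x = trans (cong ∣_∣ (ℤ.-1*i≡-i x)) (ℤ.∣-i∣≡∣i∣ x)
    ∣signOf*∣ false x = cong ∣_∣ (ℤ.*-identityˡ x)

  -- a (m ∸ i) is the coefficient of λⁱ, so the defining symmetries are Reciprocal.
  reindex : ∀ {i} (g : ℤ → ℤ) → i ℕ.≤ m → g (χ (H G) (m ℕ.∸ (m ℕ.∸ i))) ≡ g (χ (H G) i)
  reindex g i≤m = cong (g ∘ χ (H G)) (ℕ.m∸[m∸n]≡n i≤m)

  palindromic⇔ : Palindromic (H G) ⇔ Reciprocal false
  palindromic⇔ = mk⇔
    (λ pal i i≤m → trans (pal i i≤m) (trans (reindex (λ x → x) i≤m) (sym (ℤ.*-identityˡ _))))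
    (λ rec i i≤m → trans (rec i i≤m) (trans (ℤ.*-identityˡ _) (sym (reindex (λ x → x) i≤m))))

  antipalindromic⇔ : Antipalindromic (H G) ⇔ Reciprocal true
  antipalindromic⇔ = mk⇔
    (λ anti i i≤m → trans (anti i i≤m) (trans (reindex -_ i≤m) (sym (ℤ.-1*i≡-i _))))
    (λ rec i i≤m → trans (rec i i≤m) (trans (ℤ.-1*i≡-i _) (sym (reindex -_ i≤m))))

theorem1 : (n : ℕ) (G : Graph n) →
    AbsPalindromic (H G)
    × (Palindromic (H G) ⇔ (Bipartite (H G) × Even n))
    × (Antipalindromic (H G) ⇔ (Bipartite (H G) × Odd n))
theorem1 n G = absPalindromic n G ,
  (⇔-id _ ×-⇔ even⇔ n) ⇔-∘ (reciprocal⇔ n G false ⇔-∘ palindromic⇔ n G) ,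
  (⇔-id _ ×-⇔ odd⇔ n) ⇔-∘ (reciprocal⇔ n G true ⇔-∘ antipalindromic⇔ n G)
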